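{- Let $G$ be a graph on the vertex set $\{1,\dots,n\}$ with adjacency matrix $\Gamma$ over $\mathbb{F}_2$, and let $L_e(G)$ be the set of all graphs (on the vertex set $\{1,\dots,n\}$) that are edge-locally equivalent to $G$. Then $$|L_e(G)|=\frac{|\Delta_e(G)|}{|\Sigma_e(G)|},$$ where moreover $$|\Delta_e(G)|=|\{\omega\subseteq\{1,\dots,n\} \mid \Gamma[\omega]\mbox{ is nonsingular}\}|,\qquad \Sigma_e(G)=\{x\in\mathbb{F}_2^n\mid (\Gamma+I)\hat{x}(\Gamma+I)=0\}.$$
   Context: All matrices are over $\mathbb{F}_2$. Graphs are finite, undirected and simple with vertex set $V=\{1,\dots,n\}$; an adjacency matrix is a symmetric matrix over $\mathbb{F}_2$ with zero diagonal. For $x\in\mathbb{F}_2^n$, $\hat{x}$ is the diagonal $n\times n$ matrix with the entries of $x$ on the diagonal. For $\omega\subseteq\{1,\dots,n\}$, $\Gamma[\omega]=(\Gamma_{ij})_{i,j\in\omega}$ is the principal submatrix; the empty matrix counts as nonsingular. For a diagonal matrix $A$, let $H^A(\Gamma)=((A+I)\Gamma+A)(A\Gamma+A+I)^{ -1}$ whenever $A\Gamma+A+I$ is nonsingular, and let $\Delta(H^A)$ be the set of $n\times n$ adjacency matrices $\Gamma$ such that $A\Gamma+A+I$ is nonsingular and $H^A(\Gamma)$ has zero diagonal. Define $\Delta_e(G)=\{x\in\mathbb{F}_2^n\mid \Gamma\in\Delta(H^{\hat{x}})\}$ and $\Sigma_e(G)=\{x\in\mathbb{F}_2^n\mid \Gamma\in\Delta(H^{\hat{x}}),\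 H^{\hat{x}}(\Gamma)=\Gamma\}$. Local complementation: for a vertex $i$, $G*i$ is the graph on $V$ obtained from $G$ by replacing the subgraph induced on the neighborhood $N(i)$ by its complement and leaving the rest unchanged. For an edge $e=\{i,j\}$ of $G$, the edge-local complement is $G*e=((G*i)*j)*i=((G*j)*i)*j$. Two graphs $G,G'$ on $V$ are edge-locally equivalent if there is a finite (possibly empty) sequence $e_1,\dots,e_N$ of 2-element subsets of $V$ such that $e_1$ is an edge of $G$, $e_\alpha$ is an edge of $((G*e_1)*\dots)*e_{\alpha-1}$ for $\alpha=2,\dots,N$, and $((G*e_1)*\dots)*e_N=G'$. -}

module Defs where

open import Algebra.Bundles using (CommutativeRing)
open import Data.Bool.Base using (Bool; true; false; not; _∧_; _xor_; if_then_else_)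
open import Data.Bool.Properties
  using (xor-∧-commutativeRing; ∧-comm; xor-identityʳ)
open import Data.Fin.Base using (Fin; zero; suc)
open import Data.Fin.Properties using (_≟_)
open import Data.Fin.Subset using (Subset; inside; outside; ∣_∣)
open import Data.List.Base using (List; length)
import Data.List.Membership.Propositional as List
open import Data.List.Relation.Unary.Unique.Propositional using (Unique)
open import Data.Nat.Base using (ℕ)
open import Data.Product.Base using (_×_; _,_; ∃-syntax; Σ-syntax)
open import Data.Vec.Base using (Vec; []; _∷_; lookup; tabulate; map)
open import Data.Vec.Properties using (lookup∘tabulate)
open import Function.Bundles using (_⇔_)
open import Relation.Binary.Construct.Closure.ReflexiveTransitive using (Star)
open import Relation.Binary.PropositionalEquality
  using (_≡_; refl; sym; trans; cong; cong₂)
open import Relation.Nullary.Decidable.Core using (does; yes; no)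
open import Relation.Nullary.Negation.Core using (contradiction)
open import Relation.Unary using (Pred; _∈_)
open import Level using (0ℓ)

-- "|P| = k" is witnessed by a repetition-free list of length k whose members
-- are exactly the elements of P.
-- This counts elements of A, not proofs of P.

HasCardinality : {A : Set} → Pred A 0ℓ → ℕ → Set
HasCardinality {A} P k =
  Σ[ xs ∈ List A ] Unique xs × (∀ a → a List.∈ xs ⇔ a ∈ P) × length xs ≡ k

-- The field with two elements is the ring of booleans, with _xor_ as addition
-- and _∧_ as multiplication.

𝔽₂ : Set
𝔽₂ = Bool

open import Algebra.Properties.CommutativeMonoid.Sum
  (CommutativeRing.+-commutativeMonoid xor-∧-commutativeRing) using (sum)

Matrix : ℕ → ℕ → Set
Matrix m n = Vec (Vec 𝔽₂ n) m

private
  variable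
    m n p : ℕ

entry : Matrix m n → Fin m → Fin n → 𝔽₂
entry A i j = lookup (lookup A i) j

matrix : (Fin m → Fin n → 𝔽₂) → Matrix m n
matrix f = tabulate λ i → tabulate λ j → f i j

entry-matrix : (f : Fin m → Fin n → 𝔽₂) → ∀ i j → entry (matrix f) i j ≡ f i j
entry-matrix f i j =
  trans (cong (λ v → lookup v j) (lookup∘tabulate (λ i → tabulate (f i)) i))
        (lookup∘tabulate (f i) j)

infixl 6 _⊞_
infixl 7 _⊡_

_⊞_ : Matrix m n → Matrix m n → Matrix m n
A ⊞ B = matrix λ i j → entry A i j xor entry B i j

_⊡_ : Matrix m n → Matrix n p → Matrix m p
A ⊡ B = matrix λ i j → sum λ k → entry A i k ∧ entry B k j

𝟘 : Matrix m n
𝟘 = matrix λ _ _ → false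

diag : Vec 𝔽₂ n → Matrix n n
diag x = matrix λ i j → if does (i ≟ j) then lookup x i else false

𝟙 : Matrix n n
𝟙 = matrix λ i j → does (i ≟ j)

Nonsingular : Matrix n n → Set
Nonsingular {n} A = Σ[ B ∈ Matrix n n ] (A ⊡ B ≡ 𝟙) × (B ⊡ A ≡ 𝟙)

inverse : (A : Matrix n n) → Nonsingular A → Matrix n n
inverse _ (B , _) = B

ZeroDiagonal : Matrix n n → Set
ZeroDiagonal A = ∀ i → entry A i i ≡ false

elements : (ω : Subset n) → Vec (Fin n) ∣ ω ∣
elements []            = []
elements (inside  ∷ ω) = zero ∷ map suc (elements ω)
elements (outside ∷ ω) = map suc (elements ω)

_⟦_⟧ : Matrix n n → (ω : Subset n) → Matrix ∣ ω ∣ ∣ ω ∣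
Γ ⟦ ω ⟧ = matrix λ i j → entry Γ (lookup (elements ω) i) (lookup (elements ω) j)

record IsAdjacency (Γ : Matrix n n) : Set where
  field
    symmetric    : ∀ i j → entry Γ i j ≡ entry Γ j i
    zeroDiagonal : ZeroDiagonal Γ

-- The proof field is irrelevant, so that two graphs are equal as soon as their
-- adjacency matrices are.

record Graph (n : ℕ) : Set where
  constructor graph
  field
    adjacency    : Matrix n n
    .isAdjacency : IsAdjacency adjacency

open Graph public

Edge : Graph n → Fin n → Fin n → Set
Edge G i j = entry (adjacency G) i j ≡ true

-- Adding 1 exactly at the pairs of distinct neighbours of i complements the
-- subgraph induced on N(i).

complementAt : Matrix n n → Fin n → Fin n → Fin n → 𝔽₂
complementAt Γ i a b =
  entry Γ a b xor (not (does (a ≟ b)) ∧ (entry Γ i a ∧ entry Γ i b))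

private
  does-≟-sym : (a b : Fin n) → does (a ≟ b) ≡ does (b ≟ a)
  does-≟-sym a b with a ≟ b | b ≟ a
  ... | yes _  | yes _  = refl
  ... | yes eq | no ne  = contradiction (sym eq) ne
  ... | no ne  | yes eq = contradiction (sym eq) ne
  ... | no _   | no _   = refl

  does-≟-refl : (a : Fin n) → does (a ≟ a) ≡ true
  does-≟-refl a with a ≟ a
  ... | yes _ = refl
  ... | no ne = contradiction refl ne

  complementAt-adjacency : (Γ : Matrix n n) (i : Fin n) → IsAdjacency Γ →
                           IsAdjacency (matrix (complementAt Γ i))
  complementAt-adjacency Γ i adj = record
    { symmetric = λ a b →
        trans (entry-matrix (complementAt Γ i) a b)
          (trans (cong₂ _xor_ (symmetric a b)
                    (cong₂ _∧_ (cong not (does-≟-sym a b))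
                               (∧-comm (entry Γ i a) (entry Γ i b))))
                 (sym (entry-matrix (complementAt Γ i) b a)))
    ; zeroDiagonal = λ a →
        trans (entry-matrix (complementAt Γ i) a a)
          (trans (cong (λ t → entry Γ a a xor (not t ∧ (entry Γ i a ∧ entry Γ i a)))
                       (does-≟-refl a))
          (trans (xor-identityʳ (entry Γ a a)) (zeroDiagonal a)))
    }
    where open IsAdjacency adj

infixl 8 _*_

_*_ : Graph n → Fin n → Graph n
graph Γ adj * i =
  graph (matrix (complementAt Γ i)) (complementAt-adjacency Γ i adj)

EdgeLocalStep : Graph n → Graph n → Set
EdgeLocalStep G G′ = ∃[ i ] ∃[ j ] Edge G i j × G′ ≡ G * i * j * i

EdgeLocallyEquivalent : Graph n → Graph n → Set
EdgeLocallyEquivalent = Star EdgeLocalStep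

Lₑ : Graph n → Pred (Graph n) 0ℓ
Lₑ G G′ = EdgeLocallyEquivalent G G′

denominator : Matrix n n → Matrix n n → Matrix n n
denominator A Γ = A ⊡ Γ ⊞ A ⊞ 𝟙

H : (A Γ : Matrix n n) → Nonsingular (denominator A Γ) → Matrix n n
H A Γ ns = ((A ⊞ 𝟙) ⊡ Γ ⊞ A) ⊡ inverse (denominator A Γ) ns

-- Δ A is the domain Δ(H^A); only diagonal A are of interest.

Δ : Matrix n n → Pred (Matrix n n) 0ℓ
Δ A Γ = IsAdjacency Γ ×
        Σ[ ns ∈ Nonsingular (denominator A Γ) ] ZeroDiagonal (H A Γ ns)

Δₑ : Graph n → Pred (Vec 𝔽₂ n) 0ℓ
Δₑ G x = adjacency G ∈ Δ (diag x)

Σₑ : Graph n → Pred (Vec 𝔽₂ n) 0ℓ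
Σₑ G x = Σ[ (_ , ns , _) ∈ adjacency G ∈ Δ (diag x) ]
           H (diag x) (adjacency G) ns ≡ adjacency G

-- With M = Γ + 1 and A = x̂, the equation H^A(Γ) = Γ′ is equivalent to
-- M′ A M = M + M′ ("M′⁻¹ = M⁻¹ + A").  In this form pivots compose by adding
-- the vectors x, they are reversible on symmetric matrices, and the stabiliser
-- of Γ is M A M = 0.  The edge-local complement at ij is the pivot at the
-- indicator vector of {i, j}; conversely, a nontrivial pivot at x has an edge ij
-- inside the support of x, and pivoting there first shrinks that support.  So
-- Lₑ(G) is the set of values H^x(G), and its fibres are translates of Σₑ(G).
-- Finally A Γ + A + 1 is, up to a block triangular factor, the principal
-- submatrix on the support of x.

module Submission where

open import Defs
open import Algebra.Bundles using (Ring; CommutativeRing)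
import Algebra.Properties.CommutativeMonoid.Sum as CommutativeMonoidSum
import Algebra.Properties.Semiring.Sum as SemiringSum
open import Data.Bool.Base using (true; false; not; _∧_; _xor_; if_then_else_)
open import Data.Bool.Properties as Bool using
  ( xor-∧-commutativeRing; xor-same; xor-comm; xor-assoc; xor-identityʳ
  ; ∧-assoc; ∧-comm; ∧-identityʳ; ∧-zeroʳ; ∧-idem; ∧-distribˡ-xor)
import Data.Bool.Solver
open import Data.Fin.Base using (Fin; zero; suc)
open import Data.Fin.Patterns using (0F; 1F; 2F; 3F; 4F)
open import Data.Fin.Properties using (_≟_; suc-injective; any?; all?)
open import Data.Fin.Subset using (Subset; inside; outside; ∣_∣; _⊂_)
open import Data.Fin.Subset.Induction using (Acc; acc; ⊂-wellFounded)
open import Data.Integer.Base using (+_)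
import Data.Integer.Properties as ℤ
open import Data.List.Base as List using (List; []; _∷_; _++_; foldr)
import Data.List.Membership.Propositional as List
open import Data.List.Membership.Propositional.Properties
  using ( ∈-map⁺; ∈-map⁻; ∈-filter⁺; ∈-filter⁻; ∈-deduplicate⁺; ∈-deduplicate⁻
        ; ∈-cartesianProduct⁺; ∈-cartesianProduct⁻; ∈-cartesianProductWith⁺)
import Data.List.Properties as List
import Data.List.Relation.Unary.All as All
import Data.List.Relation.Unary.All.Properties as All
open import Data.List.Relation.Unary.AllPairs using ([]; _∷_)
import Data.List.Relation.Unary.Any as Any
import Data.List.Relation.Unary.Any.Properties as Any
open import Data.List.Relation.Unary.Unique.Propositional using (Unique)
import Data.List.Relation.Unary.Unique.Propositional.Properties as Unique
import Data.List.Relation.Unary.Unique.DecPropositional.Properties as DecUnique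
open import Data.Maybe.Base using (Maybe; just; nothing)
import Data.Maybe.Relation.Unary.Any as Maybe
open import Data.Nat.Base as ℕ using (ℕ; NonZero; zero; suc)
open import Data.Product.Base using (∃; Σ-syntax; ∃-syntax; _×_; _,_; proj₁; proj₂)
open import Data.Rational.Base using (_/_)
open import Data.Rational.Properties using (fromℚᵘ-cong)
open import Data.Rational.Unnormalised.Base using (mkℚᵘ; *≡*)
open import Data.Vec.Base using (Vec; []; _∷_; lookup; tabulate; zipWith; replicate)
open import Data.Vec.Properties using
  ( ≡-dec; lookup∘tabulate; tabulate∘lookup; tabulate-cong; lookup-zipWith; lookup-map
  ; lookup-replicate; lookup⇒[]=; []=⇒lookup)
open import Function.Base using (_∘_)
open import Function.Bundles using (_⇔_; mk⇔; Equivalence)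
open import Level using (0ℓ; _⊔_)
open import Relation.Binary.Construct.Closure.ReflexiveTransitive using (ε; _◅_)
open import Relation.Binary.Definitions using (DecidableEquality)
open import Relation.Binary.PropositionalEquality
  using (_≡_; _≢_; refl; sym; trans; cong; cong₂; subst; isEquivalence; module ≡-Reasoning)
open import Relation.Nullary.Decidable.Core using (Dec; does; yes; no; map′; recompute; _×-dec_)
open import Relation.Unary using (Pred; Decidable; _∈_)

-- In general M = Γ + 1 is singular (for a single edge on two vertices it is the all-ones matrix),
-- so M′⁻¹ = M⁻¹ + A is only a heuristic and no inverse of M may occur in an argument. Its formal
-- consequences are instead derived from pivot equations in the noncommutative matrix ring of
-- characteristic two, by certificates: explicit left and right multipliers of the hypotheses,
-- checked by normalisation. The multipliers come from the denominator D = A Γ + A + 1 = 1 + A M,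
-- for which the pivot equation reads M′ D = M.
--
-- The equational form serves the counting too. Membership in `Lₑ` is reachability along a `Star`,
-- which offers no evident decision procedure, yet the theorem has to produce the number of members.
-- Being a pivot at x is an equality of matrices, hence decidable, and only finitely many x have to
-- be tried. The quotient is then reached through the product |Δₑ| = |Lₑ| · |Σₑ|.

private
  variable
    m n p q : ℕ

-- Rings of characteristic two

-- A solver for noncommutative rings with 1 + 1 = 0: a polynomial is the list
-- of its words, and a word occurring twice cancels.
module Char2Solver {c ℓ} (R : Ring c ℓ)
                   (char2 : ∀ x → Ring._≈_ R (Ring._+_ R x x) (Ring.0# R)) where

  open Ring R hiding (refl; sym; trans; isEquivalence) renaming (_*_ to infixl 7 _·_)
  open import Relation.Binary.Reasoning.Setoid setoid

  infixl 6 _:+_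
  infixl 7 _:*_

  data Expr (k : ℕ) : Set where
    var       : Fin k → Expr k
    :0 :1     : Expr k
    _:+_ _:*_ : Expr k → Expr k → Expr k

  Word Poly : ℕ → Set
  Word k = List (Fin k)
  Poly k = List (Word k)

  toggle : ∀ {k} → Word k → Poly k → Poly k
  toggle w []       = w ∷ []
  toggle w (v ∷ vs) with List.≡-dec _≟_ w v
  ... | yes _ = vs
  ... | no  _ = v ∷ toggle w vs

  _⊕_ : ∀ {k} → Poly k → Poly k → Poly k
  ps ⊕ qs = foldr toggle qs ps

  _⊗_ : ∀ {k} → Poly k → Poly k → Poly k
  ps ⊗ qs = foldr (λ w r → List.map (w ++_) qs ⊕ r) [] ps

  normalise : ∀ {k} → Expr k → Poly k
  normalise (var i)    = (i ∷ []) ∷ []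
  normalise :0         = []
  normalise :1         = [] ∷ []
  normalise (e₁ :+ e₂) = normalise e₁ ⊕ normalise e₂
  normalise (e₁ :* e₂) = normalise e₁ ⊗ normalise e₂

  module _ {k : ℕ} (ρ : Vec Carrier k) where

    ⟪_⟫ : Expr k → Carrier
    ⟪ var i ⟫    = lookup ρ i
    ⟪ :0 ⟫       = 0#
    ⟪ :1 ⟫       = 1#
    ⟪ e₁ :+ e₂ ⟫ = ⟪ e₁ ⟫ + ⟪ e₂ ⟫
    ⟪ e₁ :* e₂ ⟫ = ⟪ e₁ ⟫ · ⟪ e₂ ⟫

    ⟪_⟫ʷ : Word k → Carrier
    ⟪_⟫ʷ = foldr (λ i r → lookup ρ i · r) 1#

    ⟪_⟫ᵖ : Poly k → Carrier
    ⟪_⟫ᵖ = foldr (λ w r → ⟪ w ⟫ʷ + r) 0#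

    cancel : ∀ x y → x + (x + y) ≈ y
    cancel x y = begin
      x + (x + y) ≈⟨ +-assoc x x y ⟨
      x + x + y   ≈⟨ +-congʳ (char2 x) ⟩
      0# + y      ≈⟨ +-identityˡ y ⟩
      y           ∎

    swap : ∀ x y z → x + (y + z) ≈ y + (x + z)
    swap x y z = begin
      x + (y + z) ≈⟨ +-assoc x y z ⟨
      x + y + z   ≈⟨ +-congʳ (+-comm x y) ⟩
      y + x + z   ≈⟨ +-assoc y x z ⟩
      y + (x + z) ∎

    toggle-sound : ∀ w ps → ⟪ toggle w ps ⟫ᵖ ≈ ⟪ w ⟫ʷ + ⟪ ps ⟫ᵖ
    toggle-sound w []       = Ring.refl R
    toggle-sound w (v ∷ vs) with List.≡-dec _≟_ w v
    ... | yes refl = Ring.sym R (cancel _ _)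
    ... | no  _    = begin
      ⟪ v ⟫ʷ + ⟪ toggle w vs ⟫ᵖ      ≈⟨ +-congˡ (toggle-sound w vs) ⟩
      ⟪ v ⟫ʷ + (⟪ w ⟫ʷ + ⟪ vs ⟫ᵖ)    ≈⟨ swap _ _ _ ⟩
      ⟪ w ⟫ʷ + (⟪ v ⟫ʷ + ⟪ vs ⟫ᵖ)    ∎

    ⊕-sound : ∀ ps qs → ⟪ ps ⊕ qs ⟫ᵖ ≈ ⟪ ps ⟫ᵖ + ⟪ qs ⟫ᵖ
    ⊕-sound []       qs = Ring.sym R (+-identityˡ _)
    ⊕-sound (w ∷ ps) qs = begin
      ⟪ toggle w (ps ⊕ qs) ⟫ᵖ          ≈⟨ toggle-sound w (ps ⊕ qs) ⟩
      ⟪ w ⟫ʷ + ⟪ ps ⊕ qs ⟫ᵖ            ≈⟨ +-congˡ (⊕-sound ps qs) ⟩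
      ⟪ w ⟫ʷ + (⟪ ps ⟫ᵖ + ⟪ qs ⟫ᵖ)     ≈⟨ +-assoc _ _ _ ⟨
      ⟪ w ⟫ʷ + ⟪ ps ⟫ᵖ + ⟪ qs ⟫ᵖ       ∎

    ++-sound : ∀ w v → ⟪ w ++ v ⟫ʷ ≈ ⟪ w ⟫ʷ · ⟪ v ⟫ʷ
    ++-sound []      v = Ring.sym R (*-identityˡ _)
    ++-sound (i ∷ w) v = begin
      lookup ρ i · ⟪ w ++ v ⟫ʷ        ≈⟨ *-congˡ (++-sound w v) ⟩
      lookup ρ i · (⟪ w ⟫ʷ · ⟪ v ⟫ʷ)  ≈⟨ *-assoc _ _ _ ⟨
      lookup ρ i · ⟪ w ⟫ʷ · ⟪ v ⟫ʷ    ∎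

    map-sound : ∀ w qs → ⟪ List.map (w ++_) qs ⟫ᵖ ≈ ⟪ w ⟫ʷ · ⟪ qs ⟫ᵖ
    map-sound w []       = Ring.sym R (zeroʳ _)
    map-sound w (v ∷ qs) = begin
      ⟪ w ++ v ⟫ʷ + ⟪ List.map (w ++_) qs ⟫ᵖ   ≈⟨ +-cong (++-sound w v) (map-sound w qs) ⟩
      ⟪ w ⟫ʷ · ⟪ v ⟫ʷ + ⟪ w ⟫ʷ · ⟪ qs ⟫ᵖ      ≈⟨ distribˡ _ _ _ ⟨
      ⟪ w ⟫ʷ · (⟪ v ⟫ʷ + ⟪ qs ⟫ᵖ)             ∎

    ⊗-sound : ∀ ps qs → ⟪ ps ⊗ qs ⟫ᵖ ≈ ⟪ ps ⟫ᵖ · ⟪ qs ⟫ᵖ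
    ⊗-sound []       qs = Ring.sym R (zeroˡ _)
    ⊗-sound (w ∷ ps) qs = begin
      ⟪ List.map (w ++_) qs ⊕ (ps ⊗ qs) ⟫ᵖ       ≈⟨ ⊕-sound (List.map (w ++_) qs) (ps ⊗ qs) ⟩
      ⟪ List.map (w ++_) qs ⟫ᵖ + ⟪ ps ⊗ qs ⟫ᵖ    ≈⟨ +-cong (map-sound w qs) (⊗-sound ps qs) ⟩
      ⟪ w ⟫ʷ · ⟪ qs ⟫ᵖ + ⟪ ps ⟫ᵖ · ⟪ qs ⟫ᵖ       ≈⟨ distribʳ _ _ _ ⟨
      (⟪ w ⟫ʷ + ⟪ ps ⟫ᵖ) · ⟪ qs ⟫ᵖ               ∎

    normalise-sound : ∀ e → ⟪ normalise e ⟫ᵖ ≈ ⟪ e ⟫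
    normalise-sound (var i)    = Ring.trans R (+-identityʳ _) (*-identityʳ _)
    normalise-sound :0         = Ring.refl R
    normalise-sound :1         = +-identityʳ _
    normalise-sound (e₁ :+ e₂) =
      Ring.trans R (⊕-sound (normalise e₁) (normalise e₂))
                   (+-cong (normalise-sound e₁) (normalise-sound e₂))
    normalise-sound (e₁ :* e₂) =
      Ring.trans R (⊗-sound (normalise e₁) (normalise e₂))
                   (*-cong (normalise-sound e₁) (normalise-sound e₂))

    -- The multiple a (l + r) b of the hypothesis l ≈ r.
    record Multiple : Set (c ⊔ ℓ) where
      constructor _·[_≈_by_]·_
      field
        a l r : Expr k
        l≈r   : ⟪ l ⟫ ≈ ⟪ r ⟫
        b     : Expr k

    infixl 5 _plus_

    _plus_ : Expr k → List Multiple → Expr k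
    e plus []                          = e
    e plus ((a ·[ l ≈ r by _ ]· b) ∷ ms) = e :+ a :* (l :+ r) :* b plus ms

    plus-sound : ∀ e ms → ⟪ e plus ms ⟫ ≈ ⟪ e ⟫
    plus-sound e []                            = Ring.refl R
    plus-sound e ((a ·[ l ≈ r by l≈r ]· b) ∷ ms) = begin
      ⟪ e :+ a :* (l :+ r) :* b plus ms ⟫          ≈⟨ plus-sound (e :+ a :* (l :+ r) :* b) ms ⟩
      ⟪ e ⟫ + ⟪ a ⟫ · (⟪ l ⟫ + ⟪ r ⟫) · ⟪ b ⟫      ≈⟨ +-congˡ (*-congʳ (*-congˡ (+-congʳ l≈r))) ⟩
      ⟪ e ⟫ + ⟪ a ⟫ · (⟪ r ⟫ + ⟪ r ⟫) · ⟪ b ⟫      ≈⟨ +-congˡ (*-congʳ (*-congˡ (char2 ⟪ r ⟫))) ⟩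
      ⟪ e ⟫ + ⟪ a ⟫ · 0# · ⟪ b ⟫                   ≈⟨ +-congˡ (*-congʳ (zeroʳ ⟪ a ⟫)) ⟩
      ⟪ e ⟫ + 0# · ⟪ b ⟫                           ≈⟨ +-congˡ (zeroˡ ⟪ b ⟫) ⟩
      ⟪ e ⟫ + 0#                                   ≈⟨ +-identityʳ ⟪ e ⟫ ⟩
      ⟪ e ⟫                                        ∎

    -- The multiples certify that e₁ + e₂ lies in the ideal of the hypotheses.
    solve : ∀ e₁ e₂ ms → normalise (e₁ :+ e₂ plus ms) ≡ [] → ⟪ e₁ ⟫ ≈ ⟪ e₂ ⟫
    solve e₁ e₂ ms eq = begin
      ⟪ e₁ ⟫                                     ≈⟨ cancel ⟪ e₂ ⟫ ⟪ e₁ ⟫ ⟨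
      ⟪ e₂ ⟫ + (⟪ e₂ ⟫ + ⟪ e₁ ⟫)                 ≈⟨ +-congˡ (+-comm _ _) ⟩
      ⟪ e₂ ⟫ + ⟪ e₁ :+ e₂ ⟫                      ≈⟨ +-congˡ (plus-sound (e₁ :+ e₂) ms) ⟨
      ⟪ e₂ ⟫ + ⟪ e₁ :+ e₂ plus ms ⟫              ≈⟨ +-congˡ (normalise-sound (e₁ :+ e₂ plus ms)) ⟨
      ⟪ e₂ ⟫ + ⟪ normalise (e₁ :+ e₂ plus ms) ⟫ᵖ ≡⟨ cong (λ ps → ⟪ e₂ ⟫ + ⟪ ps ⟫ᵖ) eq ⟩
      ⟪ e₂ ⟫ + 0#                                ≈⟨ +-identityʳ _ ⟩
      ⟪ e₂ ⟫                                     ∎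

-- Matrices over 𝔽₂

open CommutativeMonoidSum (CommutativeRing.+-commutativeMonoid xor-∧-commutativeRing)
  using (sum; sum-cong-≗; sum-replicate-zero; ∑-distrib-+; ∑-comm)
open SemiringSum (CommutativeRing.semiring xor-∧-commutativeRing)
  using (*-distribˡ-sum; *-distribʳ-sum)

open ≡-Reasoning

vec-ext : {A : Set} {u v : Vec A n} → (∀ i → lookup u i ≡ lookup v i) → u ≡ v
vec-ext {u = u} {v} eq =
  trans (sym (tabulate∘lookup u)) (trans (tabulate-cong eq) (tabulate∘lookup v))

matrix-ext : {A B : Matrix m n} → (∀ i j → entry A i j ≡ entry B i j) → A ≡ B
matrix-ext eq = vec-ext λ i → vec-ext (eq i)

entry-⊞ : (A B : Matrix m n) → ∀ i j → entry (A ⊞ B) i j ≡ entry A i j xor entry B i j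
entry-⊞ A B = entry-matrix _

entry-⊡ : (A : Matrix m n) (B : Matrix n p) → ∀ i j →
          entry (A ⊡ B) i j ≡ sum λ k → entry A i k ∧ entry B k j
entry-⊡ A B = entry-matrix _

entry-𝟘 : ∀ (i : Fin m) (j : Fin n) → entry 𝟘 i j ≡ false
entry-𝟘 = entry-matrix _

entry-𝟙 : ∀ (i j : Fin n) → entry 𝟙 i j ≡ does (i ≟ j)
entry-𝟙 = entry-matrix _

entry-diag : (x : Vec 𝔽₂ n) → ∀ i j →
             entry (diag x) i j ≡ (if does (i ≟ j) then lookup x i else false)
entry-diag x = entry-matrix _

does-≟-refl : (i : Fin n) → does (i ≟ i) ≡ true
does-≟-refl i with i ≟ i
... | yes _  = refl
... | no i≢i with () ← i≢i refl

does-≟-sym : (i j : Fin n) → does (i ≟ j) ≡ does (j ≟ i)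
does-≟-sym zero    zero    = refl
does-≟-sym zero    (suc j) = refl
does-≟-sym (suc i) zero    = refl
does-≟-sym (suc i) (suc j) = does-≟-sym i j

sum-δ : ∀ (i : Fin n) (f : Fin n → 𝔽₂) → (sum λ k → does (i ≟ k) ∧ f k) ≡ f i
sum-δ {suc n} zero    f = trans (cong (f zero xor_) (sum-replicate-zero n)) (xor-identityʳ (f zero))
sum-δ {suc n} (suc i) f = sum-δ i (f ∘ suc)

⊞-assoc : (A B C : Matrix m n) → A ⊞ B ⊞ C ≡ A ⊞ (B ⊞ C)
⊞-assoc A B C = matrix-ext λ i j → begin
  entry (A ⊞ B ⊞ C) i j                              ≡⟨ entry-⊞ (A ⊞ B) C i j ⟩
  entry (A ⊞ B) i j xor entry C i j                  ≡⟨ cong (_xor entry C i j) (entry-⊞ A B i j) ⟩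
  (entry A i j xor entry B i j) xor entry C i j      ≡⟨ xor-assoc (entry A i j) _ _ ⟩
  entry A i j xor (entry B i j xor entry C i j)      ≡⟨ cong (entry A i j xor_) (entry-⊞ B C i j) ⟨
  entry A i j xor entry (B ⊞ C) i j                  ≡⟨ entry-⊞ A (B ⊞ C) i j ⟨
  entry (A ⊞ (B ⊞ C)) i j                            ∎

⊞-comm : (A B : Matrix m n) → A ⊞ B ≡ B ⊞ A
⊞-comm A B = matrix-ext λ i j →
  trans (entry-⊞ A B i j) (trans (xor-comm (entry A i j) _) (sym (entry-⊞ B A i j)))

⊞-identityˡ : (A : Matrix m n) → 𝟘 ⊞ A ≡ A
⊞-identityˡ A = matrix-ext λ i j →
  trans (entry-⊞ 𝟘 A i j) (cong (_xor entry A i j) (entry-𝟘 i j))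

⊞-same : (A : Matrix m n) → A ⊞ A ≡ 𝟘
⊞-same A = matrix-ext λ i j →
  trans (entry-⊞ A A i j) (trans (xor-same (entry A i j)) (sym (entry-𝟘 i j)))

⊡-assoc : (A : Matrix m n) (B : Matrix n p) (C : Matrix p q) →
          A ⊡ B ⊡ C ≡ A ⊡ (B ⊡ C)
⊡-assoc A B C = matrix-ext λ i j → begin
  entry (A ⊡ B ⊡ C) i j
    ≡⟨ entry-⊡ (A ⊡ B) C i j ⟩
  (sum λ l → entry (A ⊡ B) i l ∧ entry C l j)
    ≡⟨ sum-cong-≗ (λ l → trans (cong (_∧ entry C l j) (entry-⊡ A B i l))
                               (*-distribʳ-sum (entry C l j) (λ k → entry A i k ∧ entry B k l))) ⟩
  (sum λ l → sum λ k → (entry A i k ∧ entry B k l) ∧ entry C l j)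
    ≡⟨ ∑-comm (λ l k → (entry A i k ∧ entry B k l) ∧ entry C l j) ⟩
  (sum λ k → sum λ l → (entry A i k ∧ entry B k l) ∧ entry C l j)
    ≡⟨ sum-cong-≗ (λ k → sum-cong-≗ λ l → ∧-assoc (entry A i k) (entry B k l) (entry C l j)) ⟩
  (sum λ k → sum λ l → entry A i k ∧ (entry B k l ∧ entry C l j))
    ≡⟨ sum-cong-≗ (λ k → trans (cong (entry A i k ∧_) (entry-⊡ B C k j))
                               (*-distribˡ-sum (entry A i k) (λ l → entry B k l ∧ entry C l j))) ⟨
  (sum λ k → entry A i k ∧ entry (B ⊡ C) k j)
    ≡⟨ entry-⊡ A (B ⊡ C) i j ⟨
  entry (A ⊡ (B ⊡ C)) i j ∎

⊡-identityˡ : (A : Matrix m n) → 𝟙 ⊡ A ≡ A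
⊡-identityˡ A = matrix-ext λ i j → begin
  entry (𝟙 ⊡ A) i j                        ≡⟨ entry-⊡ 𝟙 A i j ⟩
  (sum λ k → entry 𝟙 i k ∧ entry A k j)    ≡⟨ sum-cong-≗ (λ k → cong (_∧ entry A k j) (entry-𝟙 i k)) ⟩
  (sum λ k → does (i ≟ k) ∧ entry A k j)   ≡⟨ sum-δ i (λ k → entry A k j) ⟩
  entry A i j                              ∎

⊡-distribˡ-⊞ : (A : Matrix m n) (B C : Matrix n p) → A ⊡ (B ⊞ C) ≡ A ⊡ B ⊞ A ⊡ C
⊡-distribˡ-⊞ A B C = matrix-ext λ i j → begin
  entry (A ⊡ (B ⊞ C)) i j
    ≡⟨ entry-⊡ A (B ⊞ C) i j ⟩
  (sum λ k → entry A i k ∧ entry (B ⊞ C) k j)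
    ≡⟨ sum-cong-≗ (λ k → trans (cong (entry A i k ∧_) (entry-⊞ B C k j))
                               (∧-distribˡ-xor (entry A i k) _ _)) ⟩
  (sum λ k → (entry A i k ∧ entry B k j) xor (entry A i k ∧ entry C k j))
    ≡⟨ ∑-distrib-+ (λ k → entry A i k ∧ entry B k j) (λ k → entry A i k ∧ entry C k j) ⟩
  (sum λ k → entry A i k ∧ entry B k j) xor (sum λ k → entry A i k ∧ entry C k j)
    ≡⟨ cong₂ _xor_ (entry-⊡ A B i j) (entry-⊡ A C i j) ⟨
  entry (A ⊡ B) i j xor entry (A ⊡ C) i j
    ≡⟨ entry-⊞ (A ⊡ B) (A ⊡ C) i j ⟨
  entry (A ⊡ B ⊞ A ⊡ C) i j ∎

-- Transposition and the matrix ring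

infix 9 _ᵀ

-- Besides expressing symmetry, transposition turns the left-handed ring laws into the right-handed
-- ones.
_ᵀ : Matrix m n → Matrix n m
A ᵀ = matrix λ i j → entry A j i

entry-ᵀ : (A : Matrix m n) → ∀ i j → entry (A ᵀ) i j ≡ entry A j i
entry-ᵀ A = entry-matrix _

ᵀ-involutive : (A : Matrix m n) → (A ᵀ) ᵀ ≡ A
ᵀ-involutive A = matrix-ext λ i j → trans (entry-ᵀ (A ᵀ) i j) (entry-ᵀ A j i)

ᵀ-⊞ : (A B : Matrix m n) → (A ⊞ B) ᵀ ≡ A ᵀ ⊞ B ᵀ
ᵀ-⊞ A B = matrix-ext λ i j → begin
  entry ((A ⊞ B) ᵀ) i j                   ≡⟨ entry-ᵀ (A ⊞ B) i j ⟩
  entry (A ⊞ B) j i                       ≡⟨ entry-⊞ A B j i ⟩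
  entry A j i xor entry B j i             ≡⟨ cong₂ _xor_ (entry-ᵀ A i j) (entry-ᵀ B i j) ⟨
  entry (A ᵀ) i j xor entry (B ᵀ) i j     ≡⟨ entry-⊞ (A ᵀ) (B ᵀ) i j ⟨
  entry (A ᵀ ⊞ B ᵀ) i j                   ∎

ᵀ-⊡ : (A : Matrix m n) (B : Matrix n p) → (A ⊡ B) ᵀ ≡ B ᵀ ⊡ A ᵀ
ᵀ-⊡ A B = matrix-ext λ i j → begin
  entry ((A ⊡ B) ᵀ) i j                        ≡⟨ entry-ᵀ (A ⊡ B) i j ⟩
  entry (A ⊡ B) j i                            ≡⟨ entry-⊡ A B j i ⟩
  (sum λ k → entry A j k ∧ entry B k i)
    ≡⟨ sum-cong-≗ (λ k → trans (∧-comm (entry A j k) _)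
                               (cong₂ _∧_ (sym (entry-ᵀ B i k)) (sym (entry-ᵀ A k j)))) ⟩
  (sum λ k → entry (B ᵀ) i k ∧ entry (A ᵀ) k j) ≡⟨ entry-⊡ (B ᵀ) (A ᵀ) i j ⟨
  entry (B ᵀ ⊡ A ᵀ) i j                        ∎

ᵀ-𝟙 : 𝟙 {n} ᵀ ≡ 𝟙
ᵀ-𝟙 = matrix-ext λ i j → begin
  entry (𝟙 ᵀ) i j  ≡⟨ entry-ᵀ 𝟙 i j ⟩
  entry 𝟙 j i      ≡⟨ entry-𝟙 j i ⟩
  does (j ≟ i)     ≡⟨ does-≟-sym j i ⟩
  does (i ≟ j)     ≡⟨ entry-𝟙 i j ⟨
  entry 𝟙 i j      ∎

⊡-identityʳ : (A : Matrix m n) → A ⊡ 𝟙 ≡ A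
⊡-identityʳ A = begin
  A ⊡ 𝟙             ≡⟨ ᵀ-involutive _ ⟨
  ((A ⊡ 𝟙) ᵀ) ᵀ     ≡⟨ cong _ᵀ (trans (ᵀ-⊡ A 𝟙) (cong (_⊡ A ᵀ) ᵀ-𝟙)) ⟩
  (𝟙 ⊡ A ᵀ) ᵀ       ≡⟨ cong _ᵀ (⊡-identityˡ (A ᵀ)) ⟩
  (A ᵀ) ᵀ           ≡⟨ ᵀ-involutive A ⟩
  A                 ∎

⊡-distribʳ-⊞ : (A : Matrix n p) (B C : Matrix m n) → (B ⊞ C) ⊡ A ≡ B ⊡ A ⊞ C ⊡ A
⊡-distribʳ-⊞ A B C = begin
  (B ⊞ C) ⊡ A                       ≡⟨ ᵀ-involutive _ ⟨
  (((B ⊞ C) ⊡ A) ᵀ) ᵀ               ≡⟨ cong _ᵀ (trans (ᵀ-⊡ (B ⊞ C) A) (cong (A ᵀ ⊡_) (ᵀ-⊞ B C))) ⟩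
  (A ᵀ ⊡ (B ᵀ ⊞ C ᵀ)) ᵀ             ≡⟨ cong _ᵀ (⊡-distribˡ-⊞ (A ᵀ) (B ᵀ) (C ᵀ)) ⟩
  (A ᵀ ⊡ B ᵀ ⊞ A ᵀ ⊡ C ᵀ) ᵀ         ≡⟨ cong _ᵀ (cong₂ _⊞_ (ᵀ-⊡ B A) (ᵀ-⊡ C A)) ⟨
  ((B ⊡ A) ᵀ ⊞ (C ⊡ A) ᵀ) ᵀ         ≡⟨ cong _ᵀ (ᵀ-⊞ (B ⊡ A) (C ⊡ A)) ⟨
  ((B ⊡ A ⊞ C ⊡ A) ᵀ) ᵀ             ≡⟨ ᵀ-involutive _ ⟩
  B ⊡ A ⊞ C ⊡ A                     ∎

matrixRing : ℕ → Ring 0ℓ 0ℓ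
matrixRing n = record
  { Carrier = Matrix n n
  ; _≈_ = _≡_
  ; _+_ = _⊞_
  ; _*_ = _⊡_
  ; -_  = λ A → A
  ; 0#  = 𝟘
  ; 1#  = 𝟙
  ; isRing = record
    { +-isAbelianGroup = record
      { isGroup = record
        { isMonoid = record
          { isSemigroup = record
            { isMagma = record { isEquivalence = isEquivalence ; ∙-cong = cong₂ _⊞_ }
            ; assoc = ⊞-assoc }
          ; identity = ⊞-identityˡ , λ A → trans (⊞-comm A 𝟘) (⊞-identityˡ A) }
        ; inverse = ⊞-same , ⊞-same
        ; ⁻¹-cong = λ eq → eq }
      ; comm = ⊞-comm }
    ; *-cong = cong₂ _⊡_
    ; *-assoc = ⊡-assoc
    ; *-identity = ⊡-identityˡ , ⊡-identityʳ
    ; distrib = ⊡-distribˡ-⊞ , ⊡-distribʳ-⊞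
    }
  }

module Solver {n : ℕ} = Char2Solver (matrixRing n) ⊞-same
open Solver using (Expr; var; :0; :1; _:+_; _:*_; _·[_≈_by_]·_; solve)

-- Diagonal matrices

⊡-diag-entry : ∀ (B : Matrix m n) x → ∀ i j → entry (B ⊡ diag x) i j ≡ entry B i j ∧ lookup x j
⊡-diag-entry B x i j = begin
  entry (B ⊡ diag x) i j                      ≡⟨ entry-⊡ B (diag x) i j ⟩
  (sum λ k → entry B i k ∧ entry (diag x) k j)
    ≡⟨ sum-cong-≗ (λ k → trans (cong (entry B i k ∧_) (entry-diag x k j)) (term k)) ⟩
  (sum λ k → does (j ≟ k) ∧ (entry B i k ∧ lookup x k))
    ≡⟨ sum-δ j (λ k → entry B i k ∧ lookup x k) ⟩
  entry B i j ∧ lookup x j                    ∎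
  where
  term : ∀ k → entry B i k ∧ (if does (k ≟ j) then lookup x k else false) ≡
               does (j ≟ k) ∧ (entry B i k ∧ lookup x k)
  term k rewrite does-≟-sym j k with does (k ≟ j)
  ... | true  = refl
  ... | false = ∧-zeroʳ (entry B i k)

diag-⊡-entry : ∀ x (B : Matrix n p) → ∀ i j → entry (diag x ⊡ B) i j ≡ lookup x i ∧ entry B i j
diag-⊡-entry x B i j = begin
  entry (diag x ⊡ B) i j                      ≡⟨ entry-⊡ (diag x) B i j ⟩
  (sum λ k → entry (diag x) i k ∧ entry B k j)
    ≡⟨ sum-cong-≗ (λ k → trans (cong (_∧ entry B k j) (entry-diag x i k)) (term k)) ⟩
  (sum λ k → does (i ≟ k) ∧ (lookup x i ∧ entry B k j))
    ≡⟨ sum-δ i (λ k → lookup x i ∧ entry B k j) ⟩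
  lookup x i ∧ entry B i j                    ∎
  where
  term : ∀ k → (if does (i ≟ k) then lookup x i else false) ∧ entry B k j ≡
               does (i ≟ k) ∧ (lookup x i ∧ entry B k j)
  term k with does (i ≟ k)
  ... | true  = refl
  ... | false = refl

diag-ᵀ : (x : Vec 𝔽₂ n) → diag x ᵀ ≡ diag x
diag-ᵀ x = matrix-ext λ i j →
  trans (entry-ᵀ (diag x) i j) (trans (entry-diag x j i) (trans (lemma i j) (sym (entry-diag x i j))))
  where
  lemma : ∀ i j → (if does (j ≟ i) then lookup x j else false) ≡
                  (if does (i ≟ j) then lookup x i else false)
  lemma i j with i ≟ j
  ... | yes refl rewrite does-≟-refl i = refl
  ... | no  i≢j with j ≟ i
  ...   | yes refl with () ← i≢j refl
  ...   | no  _    = refl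

-- The scalars of 𝔽₂ are idempotent. The certificates below use this relation to collapse repeated
-- factors x̂.
diag-idem : (x : Vec 𝔽₂ n) → diag x ⊡ diag x ≡ diag x
diag-idem x = matrix-ext λ i j →
  trans (⊡-diag-entry (diag x) x i j)
    (trans (cong (_∧ lookup x j) (entry-diag x i j)) (trans (lemma i j) (sym (entry-diag x i j))))
  where
  lemma : ∀ i j → (if does (i ≟ j) then lookup x i else false) ∧ lookup x j ≡
                  (if does (i ≟ j) then lookup x i else false)
  lemma i j with i ≟ j
  ... | yes refl = ∧-idem (lookup x i)
  ... | no  _    = refl

infixl 6 _⊕_

_⊕_ : Vec 𝔽₂ n → Vec 𝔽₂ n → Vec 𝔽₂ n
_⊕_ = zipWith _xor_

diag-⊕ : (x y : Vec 𝔽₂ n) → diag x ⊞ diag y ≡ diag (x ⊕ y)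
diag-⊕ x y = matrix-ext λ i j → begin
  entry (diag x ⊞ diag y) i j
    ≡⟨ entry-⊞ (diag x) (diag y) i j ⟩
  entry (diag x) i j xor entry (diag y) i j
    ≡⟨ cong₂ _xor_ (entry-diag x i j) (entry-diag y i j) ⟩
  (if does (i ≟ j) then lookup x i else false) xor (if does (i ≟ j) then lookup y i else false)
    ≡⟨ lemma i j ⟩
  (if does (i ≟ j) then lookup (x ⊕ y) i else false)
    ≡⟨ entry-diag (x ⊕ y) i j ⟨
  entry (diag (x ⊕ y)) i j ∎
  where
  lemma : ∀ i j →
    (if does (i ≟ j) then lookup x i else false) xor (if does (i ≟ j) then lookup y i else false) ≡
    (if does (i ≟ j) then lookup (x ⊕ y) i else false)
  lemma i j with does (i ≟ j)
  ... | true  = sym (lookup-zipWith _xor_ i x y)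
  ... | false = refl

-- Symmetric and alternating matrices

Symmetric : Matrix n n → Set
Symmetric A = A ᵀ ≡ A

adjacency⇒symmetric : {Γ : Matrix n n} → IsAdjacency Γ → Symmetric Γ
adjacency⇒symmetric {Γ = Γ} adj =
  matrix-ext λ i j → trans (entry-ᵀ Γ i j) (IsAdjacency.symmetric adj j i)

symmetric⇒adjacency : {Γ : Matrix n n} → Symmetric Γ → ZeroDiagonal Γ → IsAdjacency Γ
symmetric⇒adjacency {Γ = Γ} Γᵀ≡Γ zd = record
  { symmetric    = λ i j → trans (cong (λ A → entry A i j) (sym Γᵀ≡Γ)) (entry-ᵀ Γ i j)
  ; zeroDiagonal = zd }

-- Off-diagonal terms come in equal pairs, which cancel in characteristic two. The induction strips
-- the first row and the first column, which are equal by symmetry.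
sum-alternating : (f : Fin n → Fin n → 𝔽₂) → (∀ i j → f i j ≡ f j i) → (∀ i → f i i ≡ false) →
                  (sum λ i → sum (f i)) ≡ false
sum-alternating {zero}  f f-sym f-zero = refl
sum-alternating {suc n} f f-sym f-zero = begin
  (f zero zero xor row) xor (sum λ i → f (suc i) zero xor sum (f (suc i) ∘ suc))
    ≡⟨ cong₂ _xor_ (cong (_xor row) (f-zero zero))
         (∑-distrib-+ (λ i → f (suc i) zero) (λ i → sum (f (suc i) ∘ suc))) ⟩
  row xor ((sum λ i → f (suc i) zero) xor (sum λ i → sum (f (suc i) ∘ suc)))
    ≡⟨ cong (row xor_) (cong₂ _xor_ (sum-cong-≗ λ i → f-sym (suc i) zero)
         (sum-alternating (λ i j → f (suc i) (suc j)) (λ i j → f-sym (suc i) (suc j))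
                          (f-zero ∘ suc))) ⟩
  row xor (row xor false)  ≡⟨ cong (row xor_) (xor-identityʳ row) ⟩
  row xor row              ≡⟨ xor-same row ⟩
  false                    ∎
  where row = sum (f zero ∘ suc)

-- The diagonal entry at i is cᵀ Z c for the column c of `C` at i, and an alternating form vanishes
-- on every vector.
congruence-zeroDiagonal : {Z : Matrix n n} (C : Matrix n n) → IsAdjacency Z →
                          ZeroDiagonal (C ᵀ ⊡ Z ⊡ C)
congruence-zeroDiagonal {Z = Z} C adj i = begin
  entry (C ᵀ ⊡ Z ⊡ C) i i
    ≡⟨ entry-⊡ (C ᵀ ⊡ Z) C i i ⟩
  (sum λ k → entry (C ᵀ ⊡ Z) i k ∧ entry C k i)
    ≡⟨ sum-cong-≗ (λ k → cong (_∧ entry C k i)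
         (trans (entry-⊡ (C ᵀ) Z i k) (sum-cong-≗ λ l → cong (_∧ entry Z l k) (entry-ᵀ C i l)))) ⟩
  (sum λ k → (sum λ l → entry C l i ∧ entry Z l k) ∧ entry C k i)
    ≡⟨ sum-cong-≗ (λ k → *-distribʳ-sum (entry C k i) (λ l → entry C l i ∧ entry Z l k)) ⟩
  (sum λ k → sum λ l → (entry C l i ∧ entry Z l k) ∧ entry C k i)
    ≡⟨ sum-alternating _ (λ k l → term (entry C l i) (entry C k i) (symmetric l k))
         (λ k → zero-term (entry C k i) (zeroDiagonal k)) ⟩
  false ∎
  where
  open IsAdjacency adj

  term : ∀ a b {z z′} → z ≡ z′ → (a ∧ z) ∧ b ≡ (b ∧ z′) ∧ a
  term false false refl = refl
  term false true  refl = sym (∧-zeroʳ _)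
  term true  false refl = ∧-zeroʳ _
  term true  true  refl = refl

  zero-term : ∀ a {z} → z ≡ false → (a ∧ z) ∧ a ≡ false
  zero-term a refl = cong (_∧ a) (∧-zeroʳ a)

-- Principal pivots

-- With M = Γ + 1 and M′ = Γ′ + 1 this reads M′ A M = M + M′, which for
-- invertible M and M′ says M′⁻¹ = M⁻¹ + A: pivoting is an additive action.
record Pivot (A Γ Γ′ : Matrix n n) : Set where
  constructor pivot
  field equation : (Γ′ ⊞ 𝟙) ⊡ A ⊡ (Γ ⊞ 𝟙) ≡ Γ ⊞ Γ′

:pivot : ∀ {k} (a g g′ : Expr {n} k) → Expr {n} k
:pivot a g g′ = (g′ :+ :1) :* a :* (g :+ :1)

-- The hypotheses say M′ (1 + A M) = M and (1 + M″ B) M′ = M″. Evaluating (1 + M″ B) M′ (1 + A M) in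
-- both ways gives M″ (1 + A M) = (1 + M″ B) M, which is the claim; the two outer factors are the
-- multipliers of the certificate.
pivot-trans : {A B Γ Γ′ Γ″ : Matrix n n} →
              Pivot A Γ Γ′ → Pivot B Γ′ Γ″ → Pivot (A ⊞ B) Γ Γ″
pivot-trans {A = A} {B} {Γ} {Γ′} {Γ″} (pivot P) (pivot P′) = pivot (
  solve (A ∷ B ∷ Γ ∷ Γ′ ∷ Γ″ ∷ [])
    (:pivot (a :+ b) g g″) (g :+ g″)
    ( ((:1 :+ (g″ :+ :1) :* b) ·[ :pivot a g g′ ≈ g :+ g′ by P ]· :1)
    ∷ (:1 ·[ :pivot b g′ g″ ≈ g′ :+ g″ by P′ ]· (:1 :+ a :* (g :+ :1)))
    ∷ []) refl)
  where
  a b g g′ g″ : Expr 5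
  a = var 0F
  b = var 1F
  g = var 2F
  g′ = var 3F
  g″ = var 4F

-- With denominators 1 + A M′ and 1 + A M, the product differs from 1 by A times the pivot equation.
-- This is one half of invertibility; the other half comes from the reversed pivot.
pivot-denominators : {A Γ Γ′ : Matrix n n} → Pivot A Γ Γ′ →
                     denominator A Γ′ ⊡ denominator A Γ ≡ 𝟙
pivot-denominators {A = A} {Γ} {Γ′} (pivot P) =
  solve (A ∷ Γ ∷ Γ′ ∷ [])
    ((a :* g′ :+ a :+ :1) :* (a :* g :+ a :+ :1)) :1
    ((a ·[ :pivot a g g′ ≈ g :+ g′ by P ]· :1) ∷ []) refl
  where
  a g g′ : Expr 3
  a = var 0F
  g = var 1F
  g′ = var 2F

-- Transposing reverses the product M′ A M and so exchanges source and target. Reversibility of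
-- pivots on symmetric matrices comes from here.
pivot-ᵀ : {A Γ Γ′ : Matrix n n} → Pivot A Γ Γ′ → Pivot (A ᵀ) (Γ′ ᵀ) (Γ ᵀ)
pivot-ᵀ {A = A} {Γ} {Γ′} (pivot P) = pivot (begin
  (Γ ᵀ ⊞ 𝟙) ⊡ A ᵀ ⊡ (Γ′ ᵀ ⊞ 𝟙)      ≡⟨ ⊡-assoc (Γ ᵀ ⊞ 𝟙) (A ᵀ) (Γ′ ᵀ ⊞ 𝟙) ⟩
  (Γ ᵀ ⊞ 𝟙) ⊡ (A ᵀ ⊡ (Γ′ ᵀ ⊞ 𝟙))    ≡⟨ cong₂ (λ X Y → X ⊡ (A ᵀ ⊡ Y)) (ᵀ-⊞𝟙 Γ) (ᵀ-⊞𝟙 Γ′) ⟨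
  (Γ ⊞ 𝟙) ᵀ ⊡ (A ᵀ ⊡ (Γ′ ⊞ 𝟙) ᵀ)    ≡⟨ cong ((Γ ⊞ 𝟙) ᵀ ⊡_) (ᵀ-⊡ (Γ′ ⊞ 𝟙) A) ⟨
  (Γ ⊞ 𝟙) ᵀ ⊡ ((Γ′ ⊞ 𝟙) ⊡ A) ᵀ      ≡⟨ ᵀ-⊡ ((Γ′ ⊞ 𝟙) ⊡ A) (Γ ⊞ 𝟙) ⟨
  ((Γ′ ⊞ 𝟙) ⊡ A ⊡ (Γ ⊞ 𝟙)) ᵀ        ≡⟨ cong _ᵀ P ⟩
  (Γ ⊞ Γ′) ᵀ                        ≡⟨ ᵀ-⊞ Γ Γ′ ⟩
  Γ ᵀ ⊞ Γ′ ᵀ                        ≡⟨ ⊞-comm (Γ ᵀ) (Γ′ ᵀ) ⟩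
  Γ′ ᵀ ⊞ Γ ᵀ                        ∎)
  where
  ᵀ-⊞𝟙 : (B : Matrix n n) → (B ⊞ 𝟙) ᵀ ≡ B ᵀ ⊞ 𝟙
  ᵀ-⊞𝟙 B = trans (ᵀ-⊞ B 𝟙) (cong (B ᵀ ⊞_) ᵀ-𝟙)

pivot-sym : {A Γ Γ′ : Matrix n n} → Symmetric A → Symmetric Γ → Symmetric Γ′ →
            Pivot A Γ Γ′ → Pivot A Γ′ Γ
pivot-sym {A = A} {Γ} {Γ′} Aᵀ≡A Γᵀ≡Γ Γ′ᵀ≡Γ′ P =
  subst (λ B → Pivot B Γ′ Γ) Aᵀ≡A
    (subst (λ Δ → Pivot (A ᵀ) Δ Γ) Γ′ᵀ≡Γ′
      (subst (Pivot (A ᵀ) (Γ′ ᵀ)) Γᵀ≡Γ (pivot-ᵀ P)))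

-- This is the computation of `pivot-trans` with both vectors equal: the terms M″ A M′ on the two
-- sides cancel, leaving M″ = M′. The first pivot points towards `Γ`, so comparing two targets of
-- one source takes a reversal.
pivot-unique : {A Γ Γ′ Γ″ : Matrix n n} → Pivot A Γ′ Γ → Pivot A Γ Γ″ → Γ′ ≡ Γ″
pivot-unique {A = A} {Γ} {Γ′} {Γ″} (pivot P) (pivot P′) =
  solve (A ∷ Γ ∷ Γ′ ∷ Γ″ ∷ []) g′ g″
    ( ((:1 :+ (g″ :+ :1) :* a) ·[ :pivot a g′ g ≈ g′ :+ g by P ]· :1)
    ∷ (:1 ·[ :pivot a g g″ ≈ g :+ g″ by P′ ]· (:1 :+ a :* (g′ :+ :1)))
    ∷ []) refl
  where
  a g g′ g″ : Expr 4
  a = var 0F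
  g = var 1F
  g′ = var 2F
  g″ = var 3F

-- Numerator plus denominator is Γ + 1 = M, so `H` + 1 = M D⁻¹; multiplying by D = 1 + A M on the
-- right gives the pivot equation.
pivot-H : (A Γ : Matrix n n) (ns : Nonsingular (denominator A Γ)) → Pivot A Γ (H A Γ ns)
pivot-H A Γ (C , DC≡𝟙 , CD≡𝟙) = pivot (
  solve (A ∷ Γ ∷ C ∷ []) (:pivot a g (num :* c)) (g :+ num :* c)
    ((num ·[ c :* (a :* g :+ a :+ :1) ≈ :1 by CD≡𝟙 ]· :1) ∷ []) refl)
  where
  a g c num : Expr 3
  a = var 0F
  g = var 1F
  c = var 2F
  num = (a :+ :1) :* g :+ a

pivot⇒≡H : {A Γ Γ′ : Matrix n n} → Pivot A Γ Γ′ →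
           (ns : Nonsingular (denominator A Γ)) → H A Γ ns ≡ Γ′
pivot⇒≡H {A = A} {Γ} {Γ′} (pivot P) (C , DC≡𝟙 , CD≡𝟙) =
  solve (A ∷ Γ ∷ Γ′ ∷ C ∷ []) (((a :+ :1) :* g :+ a) :* c) g′
    ( (:1 ·[ :pivot a g g′ ≈ g :+ g′ by P ]· c)
    ∷ (g′ ·[ (a :* g :+ a :+ :1) :* c ≈ :1 by DC≡𝟙 ]· :1)
    ∷ []) refl
  where
  a g g′ c : Expr 4
  a = var 0F
  g = var 1F
  g′ = var 2F
  c = var 3F

pivot⇒nonsingular : {A Γ Γ′ : Matrix n n} → Pivot A Γ Γ′ → Pivot A Γ′ Γ →
                    Nonsingular (denominator A Γ)
pivot⇒nonsingular {A = A} {Γ′ = Γ′} P P⁻¹ =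
  denominator A Γ′ , pivot-denominators P⁻¹ , pivot-denominators P

-- The transpose of the pivot from `Γ` to H is a pivot from Hᵀ to `Γ`; these two are the pair that
-- `pivot-unique` compares.
H-symmetric : (A Γ : Matrix n n) → Symmetric A → Symmetric Γ →
              (ns : Nonsingular (denominator A Γ)) → Symmetric (H A Γ ns)
H-symmetric A Γ Aᵀ≡A Γᵀ≡Γ ns = pivot-unique
  (subst (λ B → Pivot B (H A Γ ns ᵀ) Γ) Aᵀ≡A
    (subst (Pivot (A ᵀ) (H A Γ ns ᵀ)) Γᵀ≡Γ (pivot-ᵀ (pivot-H A Γ ns))))
  (pivot-H A Γ ns)

-- H = Cᵀ (Dᵀ (A Γ + Γ + A)) C for the denominator D and C = D⁻¹, and the middle
-- factor Dᵀ (A Γ + Γ + A) = Γ A + A Γ + Γ is alternating.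
H-zeroDiagonal : (x : Vec 𝔽₂ n) (Γ : Matrix n n) → IsAdjacency Γ →
                 (ns : Nonsingular (denominator (diag x) Γ)) → ZeroDiagonal (H (diag x) Γ ns)
H-zeroDiagonal {n} x Γ adj ns@(C , DC≡𝟙 , CD≡𝟙) i =
  trans (cong (λ B → entry B i i) H≡CᵀZC) (congruence-zeroDiagonal C Z-adjacency i)
  where
  A Z : Matrix n n
  A = diag x
  Z = Γ ⊡ A ⊞ A ⊡ Γ ⊞ Γ

  Γᵀ≡Γ : Symmetric Γ
  Γᵀ≡Γ = adjacency⇒symmetric adj

  [ΓA]ᵀ≡AΓ : (Γ ⊡ A) ᵀ ≡ A ⊡ Γ
  [ΓA]ᵀ≡AΓ = trans (ᵀ-⊡ Γ A) (cong₂ _⊡_ (diag-ᵀ x) Γᵀ≡Γ)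

  [AΓ]ᵀ≡ΓA : (A ⊡ Γ) ᵀ ≡ Γ ⊡ A
  [AΓ]ᵀ≡ΓA = trans (cong _ᵀ (sym [ΓA]ᵀ≡AΓ)) (ᵀ-involutive (Γ ⊡ A))

  Z-adjacency : IsAdjacency Z
  Z-adjacency = symmetric⇒adjacency
    (begin
      Z ᵀ                             ≡⟨ ᵀ-⊞ (Γ ⊡ A ⊞ A ⊡ Γ) Γ ⟩
      (Γ ⊡ A ⊞ A ⊡ Γ) ᵀ ⊞ Γ ᵀ         ≡⟨ cong₂ _⊞_ (ᵀ-⊞ (Γ ⊡ A) (A ⊡ Γ)) Γᵀ≡Γ ⟩
      (Γ ⊡ A) ᵀ ⊞ (A ⊡ Γ) ᵀ ⊞ Γ       ≡⟨ cong₂ (λ X Y → X ⊞ Y ⊞ Γ) [ΓA]ᵀ≡AΓ [AΓ]ᵀ≡ΓA ⟩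
      A ⊡ Γ ⊞ Γ ⊡ A ⊞ Γ               ≡⟨ cong (_⊞ Γ) (⊞-comm (A ⊡ Γ) (Γ ⊡ A)) ⟩
      Z                               ∎)
    (λ j → begin
      entry Z j j
        ≡⟨ trans (entry-⊞ (Γ ⊡ A ⊞ A ⊡ Γ) Γ j j)
                 (cong₂ _xor_ (entry-⊞ (Γ ⊡ A) (A ⊡ Γ) j j) (IsAdjacency.zeroDiagonal adj j)) ⟩
      (entry (Γ ⊡ A) j j xor entry (A ⊡ Γ) j j) xor false
        ≡⟨ cong (λ b → (b xor entry (A ⊡ Γ) j j) xor false)
             (trans (sym (entry-ᵀ (Γ ⊡ A) j j)) (cong (λ B → entry B j j) [ΓA]ᵀ≡AΓ)) ⟩
      (entry (A ⊡ Γ) j j xor entry (A ⊡ Γ) j j) xor false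
        ≡⟨ cong (_xor false) (xor-same (entry (A ⊡ Γ) j j)) ⟩
      false ∎)

  CᵀDᵀ≡𝟙 : C ᵀ ⊡ (Γ ⊡ A ⊞ A ⊞ 𝟙) ≡ 𝟙
  CᵀDᵀ≡𝟙 = begin
    C ᵀ ⊡ (Γ ⊡ A ⊞ A ⊞ 𝟙)            ≡⟨ cong (C ᵀ ⊡_) (cong₂ _⊞_ (cong₂ _⊞_ [AΓ]ᵀ≡ΓA (diag-ᵀ x)) ᵀ-𝟙) ⟨
    C ᵀ ⊡ ((A ⊡ Γ) ᵀ ⊞ A ᵀ ⊞ 𝟙 ᵀ)    ≡⟨ cong (λ B → C ᵀ ⊡ (B ⊞ 𝟙 ᵀ)) (ᵀ-⊞ (A ⊡ Γ) A) ⟨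
    C ᵀ ⊡ ((A ⊡ Γ ⊞ A) ᵀ ⊞ 𝟙 ᵀ)      ≡⟨ cong (C ᵀ ⊡_) (ᵀ-⊞ (A ⊡ Γ ⊞ A) 𝟙) ⟨
    C ᵀ ⊡ denominator A Γ ᵀ          ≡⟨ ᵀ-⊡ (denominator A Γ) C ⟨
    (denominator A Γ ⊡ C) ᵀ          ≡⟨ cong _ᵀ DC≡𝟙 ⟩
    𝟙 ᵀ                              ≡⟨ ᵀ-𝟙 ⟩
    𝟙                                ∎

  H≡CᵀZC : H A Γ ns ≡ C ᵀ ⊡ Z ⊡ C
  H≡CᵀZC = solve (A ∷ Γ ∷ C ∷ C ᵀ ∷ [])
    (num :* c) (c′ :* (g :* a :+ a :* g :+ g) :* c)
    ( (:1 ·[ c′ :* (g :* a :+ a :+ :1) ≈ :1 by CᵀDᵀ≡𝟙 ]· (num :* c))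
    ∷ ((c′ :* (g :+ :1)) ·[ a :* a ≈ a by diag-idem x ]· ((g :+ :1) :* c))
    ∷ []) refl
    where
    a g c c′ num : Expr 4
    a = var 0F
    g = var 1F
    c = var 2F
    c′ = var 3F
    num = (a :+ :1) :* g :+ a

-- Principal submatrices

sum-elements : (ω : Subset n) (f : Fin n → 𝔽₂) →
               (sum λ a → f (lookup (elements ω) a)) ≡ sum λ i → lookup ω i ∧ f i
sum-elements []            f = refl
sum-elements (inside ∷ ω)  f = cong (f zero xor_)
  (trans (sum-cong-≗ λ a → cong f (lookup-map a suc (elements ω))) (sum-elements ω (f ∘ suc)))
sum-elements (outside ∷ ω) f =
  trans (sum-cong-≗ λ a → cong f (lookup-map a suc (elements ω))) (sum-elements ω (f ∘ suc))

elements-injective : (ω : Subset n) → ∀ {a b} →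
                     lookup (elements ω) a ≡ lookup (elements ω) b → a ≡ b
elements-injective (inside ∷ ω) {zero}  {zero}  eq = refl
elements-injective (inside ∷ ω) {zero}  {suc b} eq
  with () ← trans eq (lookup-map b suc (elements ω))
elements-injective (inside ∷ ω) {suc a} {zero}  eq
  with () ← trans (sym eq) (lookup-map a suc (elements ω))
elements-injective (inside ∷ ω) {suc a} {suc b} eq = cong suc (elements-injective ω (suc-injective
  (trans (sym (lookup-map a suc (elements ω))) (trans eq (lookup-map b suc (elements ω))))))
elements-injective (outside ∷ ω) {a} {b} eq = elements-injective ω (suc-injective
  (trans (sym (lookup-map a suc (elements ω))) (trans eq (lookup-map b suc (elements ω)))))

module _ {n : ℕ} (ω : Subset n) where

  private
    el : Fin ∣ ω ∣ → Fin n
    el = lookup (elements ω)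

  -- This is the coordinate embedding E with Eᵀ E = 1 and E Eᵀ = x̂ for x = `ω`. It expresses
  -- passage to a principal submatrix by products; these are rectangular, so they are reassociated
  -- by hand until a square matrix is left for the ring solver.
  inclusion : Matrix n ∣ ω ∣
  inclusion = matrix λ i a → does (i ≟ el a)

  ⊡-inclusion : (B : Matrix m n) → ∀ i a → entry (B ⊡ inclusion) i a ≡ entry B i (el a)
  ⊡-inclusion B i a = begin
    entry (B ⊡ inclusion) i a                       ≡⟨ entry-⊡ B inclusion i a ⟩
    (sum λ k → entry B i k ∧ entry inclusion k a)
      ≡⟨ sum-cong-≗ (λ k → trans (cong (entry B i k ∧_) (trans (entry-matrix _ k a) (does-≟-sym k (el a))))
                                 (∧-comm (entry B i k) _)) ⟩
    (sum λ k → does (el a ≟ k) ∧ entry B i k)       ≡⟨ sum-δ (el a) (entry B i) ⟩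
    entry B i (el a)                                ∎

  inclusionᵀ-⊡ : (B : Matrix n m) → ∀ a j → entry (inclusion ᵀ ⊡ B) a j ≡ entry B (el a) j
  inclusionᵀ-⊡ B a j = begin
    entry (inclusion ᵀ ⊡ B) a j              ≡⟨ cong (λ X → entry (inclusion ᵀ ⊡ X) a j) (ᵀ-involutive B) ⟨
    entry (inclusion ᵀ ⊡ (B ᵀ) ᵀ) a j        ≡⟨ cong (λ X → entry X a j) (ᵀ-⊡ (B ᵀ) inclusion) ⟨
    entry ((B ᵀ ⊡ inclusion) ᵀ) a j          ≡⟨ entry-ᵀ (B ᵀ ⊡ inclusion) a j ⟩
    entry (B ᵀ ⊡ inclusion) j a              ≡⟨ ⊡-inclusion (B ᵀ) j a ⟩
    entry (B ᵀ) j (el a)                     ≡⟨ entry-ᵀ B j (el a) ⟩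
    entry B (el a) j                         ∎

  inclusionᵀ⊡inclusion : inclusion ᵀ ⊡ inclusion ≡ 𝟙
  inclusionᵀ⊡inclusion = matrix-ext λ a b → begin
    entry (inclusion ᵀ ⊡ inclusion) a b  ≡⟨ ⊡-inclusion (inclusion ᵀ) a b ⟩
    entry (inclusion ᵀ) a (el b)         ≡⟨ entry-ᵀ inclusion a (el b) ⟩
    entry inclusion (el b) a             ≡⟨ entry-matrix _ (el b) a ⟩
    does (el b ≟ el a)                   ≡⟨ δ b a ⟩
    does (b ≟ a)                         ≡⟨ does-≟-sym b a ⟩
    does (a ≟ b)                         ≡⟨ entry-𝟙 a b ⟨
    entry 𝟙 a b                          ∎
    where
    δ : ∀ b a → does (el b ≟ el a) ≡ does (b ≟ a)
    δ b a with b ≟ a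
    ... | yes refl = does-≟-refl (el b)
    ... | no  b≢a with el b ≟ el a
    ...   | yes eq with () ← b≢a (elements-injective ω eq)
    ...   | no  _  = refl

  inclusion⊡inclusionᵀ : inclusion ⊡ inclusion ᵀ ≡ diag ω
  inclusion⊡inclusionᵀ = matrix-ext λ i j → begin
    entry (inclusion ⊡ inclusion ᵀ) i j
      ≡⟨ entry-⊡ inclusion (inclusion ᵀ) i j ⟩
    (sum λ a → entry inclusion i a ∧ entry (inclusion ᵀ) a j)
      ≡⟨ sum-cong-≗ (λ a → cong₂ _∧_ (entry-matrix _ i a)
                                     (trans (entry-ᵀ inclusion a j) (entry-matrix _ j a))) ⟩
    (sum λ a → does (i ≟ el a) ∧ does (j ≟ el a))
      ≡⟨ sum-elements ω (λ k → does (i ≟ k) ∧ does (j ≟ k)) ⟩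
    (sum λ k → lookup ω k ∧ (does (i ≟ k) ∧ does (j ≟ k)))
      ≡⟨ sum-cong-≗ (λ k → swap (lookup ω k) (does (i ≟ k)) (does (j ≟ k))) ⟩
    (sum λ k → does (i ≟ k) ∧ (lookup ω k ∧ does (j ≟ k)))
      ≡⟨ sum-δ i (λ k → lookup ω k ∧ does (j ≟ k)) ⟩
    lookup ω i ∧ does (j ≟ i)
      ≡⟨ cong (lookup ω i ∧_) (does-≟-sym j i) ⟩
    lookup ω i ∧ does (i ≟ j)
      ≡⟨ ∧-if (lookup ω i) (does (i ≟ j)) ⟩
    (if does (i ≟ j) then lookup ω i else false)
      ≡⟨ entry-diag ω i j ⟨
    entry (diag ω) i j ∎
    where
    swap : ∀ a b c → a ∧ (b ∧ c) ≡ b ∧ (a ∧ c)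
    swap false false c = refl
    swap false true  c = refl
    swap true  false c = refl
    swap true  true  c = refl

    ∧-if : ∀ a b → a ∧ b ≡ (if b then a else false)
    ∧-if a false = ∧-zeroʳ a
    ∧-if a true  = ∧-identityʳ a

  principal-submatrix : (Γ : Matrix n n) → inclusion ᵀ ⊡ Γ ⊡ inclusion ≡ Γ ⟦ ω ⟧
  principal-submatrix Γ = matrix-ext λ a b → begin
    entry (inclusion ᵀ ⊡ Γ ⊡ inclusion) a b  ≡⟨ ⊡-inclusion (inclusion ᵀ ⊡ Γ) a b ⟩
    entry (inclusion ᵀ ⊡ Γ) a (el b)         ≡⟨ inclusionᵀ-⊡ Γ a (el b) ⟩
    entry Γ (el a) (el b)                    ≡⟨ entry-matrix _ a b ⟨
    entry (Γ ⟦ ω ⟧) a b                      ∎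

  private
    E : Matrix n ∣ ω ∣
    E = inclusion

    F : Matrix ∣ ω ∣ n
    F = inclusion ᵀ

    A : Matrix n n
    A = diag ω

  A⊡E≡E : A ⊡ E ≡ E
  A⊡E≡E = begin
    A ⊡ E        ≡⟨ cong (_⊡ E) inclusion⊡inclusionᵀ ⟨
    E ⊡ F ⊡ E    ≡⟨ ⊡-assoc E F E ⟩
    E ⊡ (F ⊡ E)  ≡⟨ cong (E ⊡_) inclusionᵀ⊡inclusion ⟩
    E ⊡ 𝟙        ≡⟨ ⊡-identityʳ E ⟩
    E            ∎

  F⊡A≡F : F ⊡ A ≡ F
  F⊡A≡F = begin
    F ⊡ A        ≡⟨ cong (F ⊡_) inclusion⊡inclusionᵀ ⟨
    F ⊡ (E ⊡ F)  ≡⟨ ⊡-assoc F E F ⟨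
    F ⊡ E ⊡ F    ≡⟨ cong (_⊡ F) inclusionᵀ⊡inclusion ⟩
    𝟙 ⊡ F        ≡⟨ ⊡-identityˡ F ⟩
    F            ∎

  -- In block form D = [[Γ₁₁, Γ₁₂], [0, 1]] has inverse [[B, B Γ₁₂], [0, 1]] for
  -- B = Γ₁₁⁻¹.
  submatrix⇒denominator : (Γ : Matrix n n) → Nonsingular (Γ ⟦ ω ⟧) → Nonsingular (denominator A Γ)
  submatrix⇒denominator Γ (B , SB≡𝟙 , BS≡𝟙) =
    C ,
    solve (A ∷ Γ ∷ K ∷ []) ((a :* g :+ a :+ :1) :* c) :1
      ( (:1 ·[ a :* g :* k ≈ a by AΓK≡A ]· t)
      ∷ (:1 ·[ a :* k ≈ k by AK≡K ]· t)
      ∷ (:1 ·[ a :* a ≈ a by diag-idem ω ]· :1)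
      ∷ []) refl ,
    solve (A ∷ Γ ∷ K ∷ []) (c :* (a :* g :+ a :+ :1)) :1
      ( ((:1 :+ k :* g) ·[ a :* a ≈ a by diag-idem ω ]· (g :+ :1))
      ∷ (:1 ·[ k :* a ≈ k by KA≡K ]· (:1 :+ g))
      ∷ (:1 ·[ k :* g :* a ≈ a by KΓA≡A ]· :1)
      ∷ []) refl
    where
    K C : Matrix n n
    -- `K` is B padded with zeros to size n. The certificates see it only through A K = K = K A, A Γ
    -- K = A and K Γ A = A.
    K = E ⊡ B ⊡ F
    C = 𝟙 ⊞ A ⊞ K ⊞ K ⊡ Γ ⊡ (𝟙 ⊞ A)

    a g k c t : Expr 3
    a = var 0F
    g = var 1F
    k = var 2F
    c = :1 :+ a :+ k :+ k :* g :* (:1 :+ a)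
    t = :1 :+ g :* (:1 :+ a)

    AK≡K : A ⊡ K ≡ K
    AK≡K = begin
      A ⊡ (E ⊡ B ⊡ F)    ≡⟨ ⊡-assoc A (E ⊡ B) F ⟨
      A ⊡ (E ⊡ B) ⊡ F    ≡⟨ cong (_⊡ F) (⊡-assoc A E B) ⟨
      A ⊡ E ⊡ B ⊡ F      ≡⟨ cong (λ X → X ⊡ B ⊡ F) A⊡E≡E ⟩
      E ⊡ B ⊡ F          ∎

    KA≡K : K ⊡ A ≡ K
    KA≡K = trans (⊡-assoc (E ⊡ B) F A) (cong (E ⊡ B ⊡_) F⊡A≡F)

    KΓA≡A : K ⊡ Γ ⊡ A ≡ A
    KΓA≡A = begin
      E ⊡ B ⊡ F ⊡ Γ ⊡ A              ≡⟨ cong (E ⊡ B ⊡ F ⊡ Γ ⊡_) inclusion⊡inclusionᵀ ⟨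
      E ⊡ B ⊡ F ⊡ Γ ⊡ (E ⊡ F)        ≡⟨ ⊡-assoc (E ⊡ B ⊡ F ⊡ Γ) E F ⟨
      E ⊡ B ⊡ F ⊡ Γ ⊡ E ⊡ F          ≡⟨ cong (λ X → X ⊡ E ⊡ F) (⊡-assoc (E ⊡ B) F Γ) ⟩
      E ⊡ B ⊡ (F ⊡ Γ) ⊡ E ⊡ F        ≡⟨ cong (_⊡ F) (⊡-assoc (E ⊡ B) (F ⊡ Γ) E) ⟩
      E ⊡ B ⊡ (F ⊡ Γ ⊡ E) ⊡ F        ≡⟨ cong (λ X → E ⊡ B ⊡ X ⊡ F) (principal-submatrix Γ) ⟩
      E ⊡ B ⊡ (Γ ⟦ ω ⟧) ⊡ F          ≡⟨ cong (_⊡ F) (⊡-assoc E B (Γ ⟦ ω ⟧)) ⟩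
      E ⊡ (B ⊡ (Γ ⟦ ω ⟧)) ⊡ F        ≡⟨ cong (λ X → E ⊡ X ⊡ F) BS≡𝟙 ⟩
      E ⊡ 𝟙 ⊡ F                      ≡⟨ cong (_⊡ F) (⊡-identityʳ E) ⟩
      E ⊡ F                          ≡⟨ inclusion⊡inclusionᵀ ⟩
      A                              ∎

    AΓK≡A : A ⊡ Γ ⊡ K ≡ A
    AΓK≡A = begin
      A ⊡ Γ ⊡ (E ⊡ B ⊡ F)            ≡⟨ cong (λ X → X ⊡ Γ ⊡ (E ⊡ B ⊡ F)) inclusion⊡inclusionᵀ ⟨
      E ⊡ F ⊡ Γ ⊡ (E ⊡ B ⊡ F)        ≡⟨ ⊡-assoc (E ⊡ F ⊡ Γ) (E ⊡ B) F ⟨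
      E ⊡ F ⊡ Γ ⊡ (E ⊡ B) ⊡ F        ≡⟨ cong (_⊡ F) (⊡-assoc (E ⊡ F ⊡ Γ) E B) ⟨
      E ⊡ F ⊡ Γ ⊡ E ⊡ B ⊡ F          ≡⟨ cong (λ X → X ⊡ E ⊡ B ⊡ F) (⊡-assoc E F Γ) ⟩
      E ⊡ (F ⊡ Γ) ⊡ E ⊡ B ⊡ F        ≡⟨ cong (λ X → X ⊡ B ⊡ F) (⊡-assoc E (F ⊡ Γ) E) ⟩
      E ⊡ (F ⊡ Γ ⊡ E) ⊡ B ⊡ F        ≡⟨ cong (λ X → E ⊡ X ⊡ B ⊡ F) (principal-submatrix Γ) ⟩
      E ⊡ (Γ ⟦ ω ⟧) ⊡ B ⊡ F          ≡⟨ cong (_⊡ F) (⊡-assoc E (Γ ⟦ ω ⟧) B) ⟩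
      E ⊡ ((Γ ⟦ ω ⟧) ⊡ B) ⊡ F        ≡⟨ cong (λ X → E ⊡ X ⊡ F) SB≡𝟙 ⟩
      E ⊡ 𝟙 ⊡ F                      ≡⟨ cong (_⊡ F) (⊡-identityʳ E) ⟩
      E ⊡ F                          ≡⟨ inclusion⊡inclusionᵀ ⟩
      A                              ∎

  -- F X E is the corner A X A written in the coordinates of `ω`. The hypothesis is an inverse
  -- relation in the corner ring of the idempotent A, whose unit is A itself.
  compressions-inverse : (X Y : Matrix n n) → A ⊡ X ⊡ A ⊡ Y ⊡ A ≡ A →
                         F ⊡ X ⊡ E ⊡ (F ⊡ Y ⊡ E) ≡ 𝟙
  compressions-inverse X Y AXAYA≡A = begin
    F ⊡ X ⊡ E ⊡ (F ⊡ Y ⊡ E)              ≡⟨ ⊡-assoc (F ⊡ X) E (F ⊡ Y ⊡ E) ⟩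
    F ⊡ X ⊡ (E ⊡ (F ⊡ Y ⊡ E))            ≡⟨ cong (F ⊡ X ⊡_) (⊡-assoc E (F ⊡ Y) E) ⟨
    F ⊡ X ⊡ (E ⊡ (F ⊡ Y) ⊡ E)            ≡⟨ cong (λ Z → F ⊡ X ⊡ (Z ⊡ E)) (⊡-assoc E F Y) ⟨
    F ⊡ X ⊡ (E ⊡ F ⊡ Y ⊡ E)              ≡⟨ cong (λ Z → F ⊡ X ⊡ (Z ⊡ Y ⊡ E)) inclusion⊡inclusionᵀ ⟩
    F ⊡ X ⊡ (A ⊡ Y ⊡ E)                  ≡⟨ cong₂ (λ U V → U ⊡ X ⊡ (A ⊡ Y ⊡ V)) F⊡A≡F A⊡E≡E ⟨
    F ⊡ A ⊡ X ⊡ (A ⊡ Y ⊡ (A ⊡ E))        ≡⟨ cong (F ⊡ A ⊡ X ⊡_) (⊡-assoc (A ⊡ Y) A E) ⟨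
    F ⊡ A ⊡ X ⊡ (A ⊡ Y ⊡ A ⊡ E)          ≡⟨ ⊡-assoc (F ⊡ A ⊡ X) (A ⊡ Y ⊡ A) E ⟨
    F ⊡ A ⊡ X ⊡ (A ⊡ Y ⊡ A) ⊡ E          ≡⟨ cong (λ Z → Z ⊡ (A ⊡ Y ⊡ A) ⊡ E) (⊡-assoc F A X) ⟩
    F ⊡ (A ⊡ X) ⊡ (A ⊡ Y ⊡ A) ⊡ E        ≡⟨ cong (_⊡ E) (⊡-assoc F (A ⊡ X) (A ⊡ Y ⊡ A)) ⟩
    F ⊡ (A ⊡ X ⊡ (A ⊡ Y ⊡ A)) ⊡ E        ≡⟨ cong (λ Z → F ⊡ Z ⊡ E) AX[AYA]≡A ⟩
    F ⊡ A ⊡ E                            ≡⟨ cong (_⊡ E) F⊡A≡F ⟩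
    F ⊡ E                                ≡⟨ inclusionᵀ⊡inclusion ⟩
    𝟙                                    ∎
    where
    AX[AYA]≡A : A ⊡ X ⊡ (A ⊡ Y ⊡ A) ≡ A
    AX[AYA]≡A = begin
      A ⊡ X ⊡ (A ⊡ Y ⊡ A)    ≡⟨ ⊡-assoc (A ⊡ X) (A ⊡ Y) A ⟨
      A ⊡ X ⊡ (A ⊡ Y) ⊡ A    ≡⟨ cong (_⊡ A) (⊡-assoc (A ⊡ X) A Y) ⟨
      A ⊡ X ⊡ A ⊡ Y ⊡ A      ≡⟨ AXAYA≡A ⟩
      A                      ∎

  -- Outside `ω` the rows of D are those of the identity: (1 + A) D = 1 + A. Hence C A = A C A, and
  -- with A D = A Γ the identity A (D C) A = A becomes A Γ A C A = A. The other order follows from D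
  -- A = A Γ A.
  denominator⇒submatrix : (Γ : Matrix n n) → Nonsingular (denominator A Γ) → Nonsingular (Γ ⟦ ω ⟧)
  denominator⇒submatrix Γ (C , DC≡𝟙 , CD≡𝟙) =
    F ⊡ C ⊡ E ,
    trans (cong (_⊡ (F ⊡ C ⊡ E)) (sym (principal-submatrix Γ)))
      (compressions-inverse Γ C (solve (A ∷ Γ ∷ C ∷ []) (a :* g :* a :* c :* a) a
        ( (((:1 :+ a :* g) :* (:1 :+ a) :+ :1) ·[ (a :* g :+ a :+ :1) :* c ≈ :1 by DC≡𝟙 ]· a)
        ∷ ((:1 :+ a :* g) ·[ a :* a ≈ a by diag-idem ω ]· ((g :+ :1) :* c :* a :+ :1))
        ∷ []) refl)) ,
    trans (cong (F ⊡ C ⊡ E ⊡_) (sym (principal-submatrix Γ)))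
      (compressions-inverse C Γ (solve (A ∷ Γ ∷ C ∷ []) (a :* c :* a :* g :* a) a
        ( (a ·[ c :* (a :* g :+ a :+ :1) ≈ :1 by CD≡𝟙 ]· a)
        ∷ ((:1 :+ a :* c) ·[ a :* a ≈ a by diag-idem ω ]· :1)
        ∷ []) refl))
    where
    a g c : Expr 3
    a = var 0F
    g = var 1F
    c = var 2F

-- Edge-local complementation

-- Codes (Γᵢₐ, Γⱼₐ, [i = a], [j = a]) of a vertex a relative to an edge ij.
module 𝔹 = Data.Bool.Solver.xor-∧-Solver

data VertexCode : (g h p q : 𝔽₂) → Set where
  at-i  : VertexCode false true true false
  at-j  : VertexCode true false false true
  other : ∀ g h → VertexCode g h false false

-- The entries of row j of G * i and of row i of G * i * j.
private
  u : (g h q : 𝔽₂) → 𝔽₂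
  u g h q = h xor (not q ∧ g)

  v : (g h p q : 𝔽₂) → 𝔽₂
  v g h p q = g xor (not p ∧ u g h q)

  :identity : ∀ {k} (g h p q g′ h′ p′ q′ : 𝔹.Polynomial k) → 𝔹.Polynomial k × 𝔹.Polynomial k
  :identity g h p q g′ h′ p′ q′ =
    ((g 𝔹.:* g′) 𝔹.:+ (:u g h q 𝔹.:* :u g′ h′ q′)) 𝔹.:+ (:v g h p q 𝔹.:* :v g′ h′ p′ q′) 𝔹.:=
    ((h 𝔹.:+ q) 𝔹.:* (g′ 𝔹.:+ p′)) 𝔹.:+ ((g 𝔹.:+ p) 𝔹.:* (h′ 𝔹.:+ q′))
    where
    :u : ∀ {k} (g h q : 𝔹.Polynomial k) → 𝔹.Polynomial k
    :u g h q = h 𝔹.:+ ((𝔹.con true 𝔹.:+ q) 𝔹.:* g)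

    :v : ∀ {k} (g h p q : 𝔹.Polynomial k) → 𝔹.Polynomial k
    :v g h p q = g 𝔹.:+ ((𝔹.con true 𝔹.:+ p) 𝔹.:* :u g h q)

  :false :true : ∀ {k} → 𝔹.Polynomial k
  :false = 𝔹.con false
  :true = 𝔹.con true

-- The left side collects what the three local complementations add at a pair of distinct vertices,
-- the right side what the pivot adds. Away from i and j one has u = g + h and v = h, and the
-- identity is g g′ + (g + h)(g′ + h′) + h h′ = h g′ + g h′; the pairs meeting i or j need their own
-- codes because a centre is not its own neighbour.
pivot-identity : ∀ {g h p q g′ h′ p′ q′} → VertexCode g h p q → VertexCode g′ h′ p′ q′ →
                 p ∧ p′ ≡ false → q ∧ q′ ≡ false →
                 ((g ∧ g′) xor (u g h q ∧ u g′ h′ q′)) xor (v g h p q ∧ v g′ h′ p′ q′) ≡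
                 ((h xor q) ∧ (g′ xor p′)) xor ((g xor p) ∧ (h′ xor q′))
pivot-identity at-i at-i () _
pivot-identity at-j at-j _ ()
pivot-identity at-i at-j _ _ = refl
pivot-identity at-j at-i _ _ = refl
pivot-identity at-i (other g′ h′) _ _ =
  𝔹.solve 2 (λ g′ h′ → :identity :false :true :true :false g′ h′ :false :false) refl g′ h′
pivot-identity at-j (other g′ h′) _ _ =
  𝔹.solve 2 (λ g′ h′ → :identity :true :false :false :true g′ h′ :false :false) refl g′ h′
pivot-identity (other g h) at-i _ _ =
  𝔹.solve 2 (λ g h → :identity g h :false :false :false :true :true :false) refl g h
pivot-identity (other g h) at-j _ _ =
  𝔹.solve 2 (λ g h → :identity g h :false :false :true :false :false :true) refl g h
pivot-identity (other g h) (other g′ h′) _ _ =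
  𝔹.solve 4 (λ g h g′ h′ → :identity g h :false :false g′ h′ :false :false) refl g h g′ h′

module EdgePivot {Γ : Matrix n n} (adj : IsAdjacency Γ) {i j : Fin n}
                 (ij : entry Γ i j ≡ true) where

  open IsAdjacency adj

  ji : entry Γ j i ≡ true
  ji = trans (symmetric j i) ij

  Γ₁ Γ₂ Γ₃ : Matrix n n
  Γ₁ = matrix (complementAt Γ i)
  Γ₂ = matrix (complementAt Γ₁ j)
  Γ₃ = matrix (complementAt Γ₂ i)

  vertexCode : ∀ a → VertexCode (entry Γ i a) (entry Γ j a) (does (i ≟ a)) (does (j ≟ a))
  vertexCode a with i ≟ a | j ≟ a
  ... | yes refl | yes refl with () ← trans (sym ij) (zeroDiagonal i)
  ... | yes refl | no _ rewrite zeroDiagonal i | ji = at-i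
  ... | no _ | yes refl rewrite zeroDiagonal j | ij = at-j
  ... | no _ | no _ = other (entry Γ i a) (entry Γ j a)

  Γ₁-row-i : ∀ b → entry Γ₁ i b ≡ entry Γ i b
  Γ₁-row-i b = begin
    entry Γ₁ i b
      ≡⟨ entry-matrix (complementAt Γ i) i b ⟩
    entry Γ i b xor (not (does (i ≟ b)) ∧ (entry Γ i i ∧ entry Γ i b))
      ≡⟨ cong (λ t → entry Γ i b xor (not (does (i ≟ b)) ∧ (t ∧ entry Γ i b))) (zeroDiagonal i) ⟩
    entry Γ i b xor (not (does (i ≟ b)) ∧ false)
      ≡⟨ cong (entry Γ i b xor_) (∧-zeroʳ (not (does (i ≟ b)))) ⟩
    entry Γ i b xor false
      ≡⟨ xor-identityʳ (entry Γ i b) ⟩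
    entry Γ i b ∎

  Γ₁-row-j : ∀ b → entry Γ₁ j b ≡ u (entry Γ i b) (entry Γ j b) (does (j ≟ b))
  Γ₁-row-j b = trans (entry-matrix (complementAt Γ i) j b)
    (cong (λ t → entry Γ j b xor (not (does (j ≟ b)) ∧ (t ∧ entry Γ i b))) ij)

  Γ₂-row-i : ∀ b → entry Γ₂ i b ≡ v (entry Γ i b) (entry Γ j b) (does (i ≟ b)) (does (j ≟ b))
  Γ₂-row-i b = begin
    entry Γ₂ i b
      ≡⟨ entry-matrix (complementAt Γ₁ j) i b ⟩
    entry Γ₁ i b xor (not (does (i ≟ b)) ∧ (entry Γ₁ j i ∧ entry Γ₁ j b))
      ≡⟨ cong₂ (λ s t → s xor (not (does (i ≟ b)) ∧ (t ∧ entry Γ₁ j b))) (Γ₁-row-i b) Γ₁ji ⟩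
    entry Γ i b xor (not (does (i ≟ b)) ∧ entry Γ₁ j b)
      ≡⟨ cong (λ t → entry Γ i b xor (not (does (i ≟ b)) ∧ t)) (Γ₁-row-j b) ⟩
    v (entry Γ i b) (entry Γ j b) (does (i ≟ b)) (does (j ≟ b)) ∎
    where
    Γ₁ji : entry Γ₁ j i ≡ true
    Γ₁ji = begin
      entry Γ₁ j i                                       ≡⟨ Γ₁-row-j i ⟩
      u (entry Γ i i) (entry Γ j i) (does (j ≟ i))       ≡⟨ cong₂ (λ s t → u s t (does (j ≟ i))) (zeroDiagonal i) ji ⟩
      not (not (does (j ≟ i)) ∧ false)                   ≡⟨ cong not (∧-zeroʳ (not (does (j ≟ i)))) ⟩
      true                                               ∎

  M M₃ : Fin n → Fin n → 𝔽₂
  M  a b = entry Γ a b xor does (a ≟ b)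
  M₃ a b = entry Γ₃ a b xor does (a ≟ b)

  does-≢ : {a b : Fin n} → a ≢ b → does (a ≟ b) ≡ false
  does-≢ {a} {b} a≢b with a ≟ b
  ... | yes a≡b with () ← a≢b a≡b
  ... | no  _   = refl

  not-both : ∀ {a b : Fin n} → a ≢ b → ∀ k → does (k ≟ a) ∧ does (k ≟ b) ≡ false
  not-both {a} {b} a≢b k with k ≟ a | k ≟ b
  ... | yes refl | yes refl with () ← a≢b refl
  ... | yes _    | no  _    = refl
  ... | no  _    | _        = refl

  -- Edge-local complementation adds to M an alternating matrix of rank at most two, built from the
  -- rows i and j. On the diagonal its two products coincide and cancel; off the diagonal this is
  -- `pivot-identity`.
  M₃-entry : ∀ a b → M₃ a b ≡ M a b xor ((M j a ∧ M i b) xor (M i a ∧ M j b))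
  M₃-entry a b with a ≟ b
  ... | yes refl = begin
    entry Γ₃ a a xor true
      ≡⟨ cong (_xor true) (trans Γ₃aa (sym (zeroDiagonal a))) ⟩
    entry Γ a a xor true
      ≡⟨ xor-identityʳ _ ⟨
    (entry Γ a a xor true) xor false
      ≡⟨ cong ((entry Γ a a xor true) xor_) (xor-same (M j a ∧ M i a)) ⟨
    (entry Γ a a xor true) xor ((M j a ∧ M i a) xor (M j a ∧ M i a))
      ≡⟨ cong (λ t → (entry Γ a a xor true) xor ((M j a ∧ M i a) xor t)) (∧-comm (M j a) (M i a)) ⟩
    (entry Γ a a xor true) xor ((M j a ∧ M i a) xor (M i a ∧ M j a)) ∎
    where
    complement-diagonal : ∀ (Δ : Matrix n n) k → entry (matrix (complementAt Δ k)) a a ≡ entry Δ a a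
    complement-diagonal Δ k = trans (entry-matrix (complementAt Δ k) a a)
      (trans (cong (λ t → entry Δ a a xor (not t ∧ (entry Δ k a ∧ entry Δ k a))) (does-≟-refl a))
             (xor-identityʳ (entry Δ a a)))

    Γ₃aa : entry Γ₃ a a ≡ false
    Γ₃aa = trans (complement-diagonal Γ₂ i) (trans (complement-diagonal Γ₁ j)
             (trans (complement-diagonal Γ i) (zeroDiagonal a)))
  ... | no a≢b = begin
    entry Γ₃ a b xor false
      ≡⟨ cong (_xor false) (trans (off-diagonal Γ₂ i)
           (cong (_xor (entry Γ₂ i a ∧ entry Γ₂ i b)) (trans (off-diagonal Γ₁ j)
             (cong (_xor (entry Γ₁ j a ∧ entry Γ₁ j b)) (off-diagonal Γ i))))) ⟩
    (((entry Γ a b xor (entry Γ i a ∧ entry Γ i b)) xor (entry Γ₁ j a ∧ entry Γ₁ j b))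
      xor (entry Γ₂ i a ∧ entry Γ₂ i b)) xor false
      ≡⟨ 𝔹.solve 4 (λ s t w z → ((s 𝔹.:+ t) 𝔹.:+ w) 𝔹.:+ z 𝔹.:+ 𝔹.con false 𝔹.:=
                                 (s 𝔹.:+ 𝔹.con false) 𝔹.:+ ((t 𝔹.:+ w) 𝔹.:+ z)) refl
           (entry Γ a b) _ (entry Γ₁ j a ∧ entry Γ₁ j b) (entry Γ₂ i a ∧ entry Γ₂ i b) ⟩
    (entry Γ a b xor false) xor
      (((entry Γ i a ∧ entry Γ i b) xor (entry Γ₁ j a ∧ entry Γ₁ j b)) xor (entry Γ₂ i a ∧ entry Γ₂ i b))
      ≡⟨ cong ((entry Γ a b xor false) xor_) (cong₂ _xor_ (cong ((entry Γ i a ∧ entry Γ i b) xor_)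
           (cong₂ _∧_ (Γ₁-row-j a) (Γ₁-row-j b))) (cong₂ _∧_ (Γ₂-row-i a) (Γ₂-row-i b))) ⟩
    _ ≡⟨ cong ((entry Γ a b xor false) xor_)
           (pivot-identity (vertexCode a) (vertexCode b) (not-both a≢b i) (not-both a≢b j)) ⟩
    (entry Γ a b xor false) xor ((M j a ∧ M i b) xor (M i a ∧ M j b)) ∎
    where
    off-diagonal : ∀ (Δ : Matrix n n) k →
                   entry (matrix (complementAt Δ k)) a b ≡ entry Δ a b xor (entry Δ k a ∧ entry Δ k b)
    off-diagonal Δ k = trans (entry-matrix (complementAt Δ k) a b)
      (cong (λ t → entry Δ a b xor (not t ∧ (entry Δ k a ∧ entry Δ k b))) (does-≢ a≢b))

  M-sym : ∀ a b → M a b ≡ M b a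
  M-sym a b = cong₂ _xor_ (symmetric a b) (does-≟-sym a b)

  i≢j : i ≢ j
  i≢j refl with () ← trans (sym ij) (zeroDiagonal i)

  Mii : M i i ≡ true
  Mii = cong₂ _xor_ (zeroDiagonal i) (does-≟-refl i)

  Mjj : M j j ≡ true
  Mjj = cong₂ _xor_ (zeroDiagonal j) (does-≟-refl j)

  Mij : M i j ≡ true
  Mij = cong₂ _xor_ ij (does-≢ i≢j)

  Mji : M j i ≡ true
  Mji = trans (M-sym j i) Mij

  -- All entries of M on {i, j} are 1, so the correction in column i is row i plus row j, and row i
  -- cancels against M itself. The operation thus interchanges the columns i and j of M.
  M₃-column-i : ∀ a → M₃ a i ≡ M j a
  M₃-column-i a = begin
    M₃ a i                                            ≡⟨ M₃-entry a i ⟩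
    M a i xor ((M j a ∧ M i i) xor (M i a ∧ M j i))   ≡⟨ cong₂ (λ s t → M a i xor ((M j a ∧ s) xor (M i a ∧ t))) Mii Mji ⟩
    M a i xor ((M j a ∧ true) xor (M i a ∧ true))     ≡⟨ cong (_xor ((M j a ∧ true) xor (M i a ∧ true))) (M-sym a i) ⟩
    M i a xor ((M j a ∧ true) xor (M i a ∧ true))
      ≡⟨ 𝔹.solve 2 (λ x y → x 𝔹.:+ ((y 𝔹.:* 𝔹.con true) 𝔹.:+ (x 𝔹.:* 𝔹.con true)) 𝔹.:= y) refl (M i a) (M j a) ⟩
    M j a                                             ∎

  M₃-column-j : ∀ a → M₃ a j ≡ M i a
  M₃-column-j a = begin
    M₃ a j                                            ≡⟨ M₃-entry a j ⟩
    M a j xor ((M j a ∧ M i j) xor (M i a ∧ M j j))   ≡⟨ cong₂ (λ s t → M a j xor ((M j a ∧ s) xor (M i a ∧ t))) Mij Mjj ⟩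
    M a j xor ((M j a ∧ true) xor (M i a ∧ true))     ≡⟨ cong (_xor ((M j a ∧ true) xor (M i a ∧ true))) (M-sym a j) ⟩
    M j a xor ((M j a ∧ true) xor (M i a ∧ true))
      ≡⟨ 𝔹.solve 2 (λ x y → y 𝔹.:+ ((y 𝔹.:* 𝔹.con true) 𝔹.:+ (x 𝔹.:* 𝔹.con true)) 𝔹.:= x) refl (M i a) (M j a) ⟩
    M i a                                             ∎

  -- Since i and j differ, the sum is the indicator of {i, j}; written with `_xor_` it splits a sum
  -- weighted by it into two sums that `sum-δ` evaluates.
  endpoints : Vec 𝔽₂ n
  endpoints = tabulate λ k → does (i ≟ k) xor does (j ≟ k)

  -- Only the columns i and j of M₃ enter M₃ x̂ M, and they are the columns j and i of M. The
  -- product is therefore the correction term of `M₃-entry`, which equals M + M₃ = Γ + Γ₃.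
  edge-pivot : Pivot (diag endpoints) Γ Γ₃
  edge-pivot = pivot (matrix-ext λ a b → begin
    entry ((Γ₃ ⊞ 𝟙) ⊡ diag endpoints ⊡ (Γ ⊞ 𝟙)) a b
      ≡⟨ entry-⊡ ((Γ₃ ⊞ 𝟙) ⊡ diag endpoints) (Γ ⊞ 𝟙) a b ⟩
    (sum λ k → entry ((Γ₃ ⊞ 𝟙) ⊡ diag endpoints) a k ∧ entry (Γ ⊞ 𝟙) k b)
      ≡⟨ sum-cong-≗ (λ k → trans (cong₂ _∧_
           (trans (⊡-diag-entry (Γ₃ ⊞ 𝟙) endpoints a k)
                  (cong₂ _∧_ (entry-⊞𝟙 Γ₃ a k) (lookup∘tabulate _ k)))
           (entry-⊞𝟙 Γ k b)) (split (M₃ a k) (does (i ≟ k)) (does (j ≟ k)) (M k b))) ⟩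
    (sum λ k → (does (i ≟ k) ∧ (M₃ a k ∧ M k b)) xor (does (j ≟ k) ∧ (M₃ a k ∧ M k b)))
      ≡⟨ ∑-distrib-+ (λ k → does (i ≟ k) ∧ (M₃ a k ∧ M k b)) _ ⟩
    (sum λ k → does (i ≟ k) ∧ (M₃ a k ∧ M k b)) xor (sum λ k → does (j ≟ k) ∧ (M₃ a k ∧ M k b))
      ≡⟨ cong₂ _xor_ (sum-δ i (λ k → M₃ a k ∧ M k b)) (sum-δ j (λ k → M₃ a k ∧ M k b)) ⟩
    (M₃ a i ∧ M i b) xor (M₃ a j ∧ M j b)
      ≡⟨ cong₂ (λ s t → (s ∧ M i b) xor (t ∧ M j b)) (M₃-column-i a) (M₃-column-j a) ⟩
    (M j a ∧ M i b) xor (M i a ∧ M j b)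
      ≡⟨ 𝔹.solve 3 (λ g e t → t 𝔹.:= g 𝔹.:+ (((g 𝔹.:+ e) 𝔹.:+ t) 𝔹.:+ e)) refl
           (entry Γ a b) (does (a ≟ b)) _ ⟩
    entry Γ a b xor ((M a b xor ((M j a ∧ M i b) xor (M i a ∧ M j b))) xor does (a ≟ b))
      ≡⟨ cong (λ t → entry Γ a b xor (t xor does (a ≟ b))) (M₃-entry a b) ⟨
    entry Γ a b xor (M₃ a b xor does (a ≟ b))
      ≡⟨ 𝔹.solve 3 (λ g g₃ e → g 𝔹.:+ ((g₃ 𝔹.:+ e) 𝔹.:+ e) 𝔹.:= g 𝔹.:+ g₃) refl
           (entry Γ a b) (entry Γ₃ a b) (does (a ≟ b)) ⟩
    entry Γ a b xor entry Γ₃ a b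
      ≡⟨ entry-⊞ Γ Γ₃ a b ⟨
    entry (Γ ⊞ Γ₃) a b ∎)
    where
    entry-⊞𝟙 : (B : Matrix n n) → ∀ a b → entry (B ⊞ 𝟙) a b ≡ entry B a b xor does (a ≟ b)
    entry-⊞𝟙 B a b = trans (entry-⊞ B 𝟙 a b) (cong (entry B a b xor_) (entry-𝟙 a b))

    split : ∀ s p q t → (s ∧ (p xor q)) ∧ t ≡ (p ∧ (s ∧ t)) xor (q ∧ (s ∧ t))
    split = 𝔹.solve 4 (λ s p q t → (s 𝔹.:* (p 𝔹.:+ q)) 𝔹.:* t 𝔹.:=
                                    (p 𝔹.:* (s 𝔹.:* t)) 𝔹.:+ (q 𝔹.:* (s 𝔹.:* t))) refl

-- Graphs related by pivots

isAdj : (G : Graph n) → IsAdjacency (adjacency G)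
isAdj (graph Γ adj) = record
  { symmetric    = λ i j → recompute (_ Bool.≟ _) (IsAdjacency.symmetric adj i j)
  ; zeroDiagonal = λ i → recompute (_ Bool.≟ _) (IsAdjacency.zeroDiagonal adj i)
  }

graph-≡ : {G G′ : Graph n} → adjacency G ≡ adjacency G′ → G ≡ G′
graph-≡ refl = refl

-- The relation G′ = H^x̂(G).
record _⟨_⟩→_ (G : Graph n) (x : Vec 𝔽₂ n) (G′ : Graph n) : Set where
  constructor pivoting
  field isPivot : Pivot (diag x) (adjacency G) (adjacency G′)

⟨⟩-refl : {G : Graph n} → G ⟨ replicate n false ⟩→ G
⟨⟩-refl {n} {graph Γ _} = pivoting (subst (λ A → Pivot A Γ Γ) (sym diag-0)
  (pivot (solve (Γ ∷ []) (:pivot :0 (var 0F) (var 0F)) (var 0F :+ var 0F) [] refl)))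
  where
  lemma : ∀ (i j : Fin n) → (if does (i ≟ j) then lookup (replicate n false) i else false) ≡ false
  lemma i j with does (i ≟ j)
  ... | true  = lookup-replicate i false
  ... | false = refl

  diag-0 : diag (replicate n false) ≡ 𝟘
  diag-0 = matrix-ext λ i j →
    trans (entry-diag (replicate n false) i j) (trans (lemma i j) (sym (entry-𝟘 i j)))

⟨⟩-sym : ∀ {x} {G G′ : Graph n} → G ⟨ x ⟩→ G′ → G′ ⟨ x ⟩→ G
⟨⟩-sym {x = x} {G} {G′} (pivoting P) = pivoting (pivot-sym (diag-ᵀ x)
  (adjacency⇒symmetric (isAdj G)) (adjacency⇒symmetric (isAdj G′)) P)

⟨⟩-trans : ∀ {x y} {G G′ G″ : Graph n} → G ⟨ x ⟩→ G′ → G′ ⟨ y ⟩→ G″ → G ⟨ x ⊕ y ⟩→ G″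
⟨⟩-trans {x = x} {y} {G} {G′} {G″} (pivoting P) (pivoting P′) =
  pivoting (subst (λ A → Pivot A (adjacency G) (adjacency G″)) (diag-⊕ x y) (pivot-trans P P′))

⟨⟩-unique : ∀ {x} {G G′ G″ : Graph n} → G ⟨ x ⟩→ G′ → G ⟨ x ⟩→ G″ → G′ ≡ G″
⟨⟩-unique P P′ = graph-≡ (pivot-unique (_⟨_⟩→_.isPivot (⟨⟩-sym P)) (_⟨_⟩→_.isPivot P′))

step⇒pivot : {G G′ : Graph n} → EdgeLocalStep G G′ → ∃[ x ] G ⟨ x ⟩→ G′
step⇒pivot {G = G} (i , j , ij , refl) = endpoints , pivoting edge-pivot
  where open EdgePivot (isAdj G) ij

Lₑ⇒pivot : {G G′ : Graph n} → Lₑ G G′ → ∃[ x ] G ⟨ x ⟩→ G′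
Lₑ⇒pivot ε        = replicate _ false , ⟨⟩-refl
Lₑ⇒pivot (s ◅ ss) =
  let x , P  = step⇒pivot s
      y , P′ = Lₑ⇒pivot ss
  in x ⊕ y , ⟨⟩-trans P P′

-- For the denominator D one has D x̂ = x̂ Γ x̂; so if x̂ Γ x̂ = 0, then x̂ = 0
-- because D is invertible.
edgeless-pivot : ∀ {x} {G G′ : Graph n} → diag x ⊡ adjacency G ⊡ diag x ≡ 𝟘 →
                 G ⟨ x ⟩→ G′ → G ≡ G′
edgeless-pivot {x = x} {G} {G′} AΓA≡𝟘 (pivoting P) = graph-≡
  (solve (diag x ∷ adjacency G ∷ adjacency G′ ∷ []) g g′
    ( (:1 ·[ :pivot a g g′ ≈ g :+ g′ by Pivot.equation P ]· :1)
    ∷ ((g′ :+ :1) ·[ d′ :* (a :* g :+ a :+ :1) ≈ :1 by pivot-denominators P ]· (a :* (g :+ :1)))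
    ∷ (((g′ :+ :1) :* d′) ·[ a :* g :* a ≈ :0 by AΓA≡𝟘 ]· (g :+ :1))
    ∷ (((g′ :+ :1) :* d′) ·[ a :* a ≈ a by diag-idem x ]· (g :+ :1))
    ∷ []) refl)
  where
  a g g′ d′ : Expr 3
  a = var 0F
  g = var 1F
  g′ = var 2F
  d′ = a :* g′ :+ a :+ :1

-- For e inside x the sum is the set difference, and i witnesses that it is proper. The order of the
-- summands is the one in which `⟨⟩-trans` produces them.
⊕-shrinks : (x e : Subset n) (i : Fin n) → (∀ k → lookup e k ≡ true → lookup x k ≡ true) →
              lookup e i ≡ true → (e ⊕ x) ⊂ x
⊕-shrinks x e i e⊆x ei =
  (λ {k} k∈ → lookup⇒[]= k x (sub k ([]=⇒lookup k∈))) ,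
  i , lookup⇒[]= i x (e⊆x i ei) , λ i∈ → absurd ([]=⇒lookup i∈)
  where
  sub : ∀ k → lookup (e ⊕ x) k ≡ true → lookup x k ≡ true
  sub k eq with lookup e k in ek
  ... | true  = e⊆x k ek
  ... | false = trans (sym (trans (lookup-zipWith _xor_ k e x) (cong (_xor lookup x k) ek))) eq

  absurd : lookup (e ⊕ x) i ≢ true
  absurd eq with () ← trans (sym eq)
    (trans (lookup-zipWith _xor_ i e x) (cong₂ _xor_ ei (e⊆x i ei)))

pivot⇒Lₑ : ∀ {x} → Acc _⊂_ x → {G G′ : Graph n} → G ⟨ x ⟩→ G′ → Lₑ G G′
pivot⇒Lₑ {x = x} (acc rec) {G} {G′} P
  -- The search runs over the entries of x̂ Γ x̂, so that its failure is precisely the hypothesis of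
  -- `edgeless-pivot`.
  with any? (λ i → any? λ j → ((lookup x i ∧ entry (adjacency G) i j) ∧ lookup x j) Bool.≟ true)
... | no ∄ij = subst (Lₑ G) (edgeless-pivot AΓA≡𝟘 P) ε
  where
  AΓA≡𝟘 : diag x ⊡ adjacency G ⊡ diag x ≡ 𝟘
  AΓA≡𝟘 = matrix-ext λ i j → begin
    entry (diag x ⊡ adjacency G ⊡ diag x) i j
      ≡⟨ ⊡-diag-entry (diag x ⊡ adjacency G) x i j ⟩
    entry (diag x ⊡ adjacency G) i j ∧ lookup x j
      ≡⟨ cong (_∧ lookup x j) (diag-⊡-entry x (adjacency G) i j) ⟩
    (lookup x i ∧ entry (adjacency G) i j) ∧ lookup x j
      ≡⟨ Bool.¬-not (λ eq → ∄ij (i , j , eq)) ⟩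
    false
      ≡⟨ entry-𝟘 i j ⟨
    entry 𝟘 i j ∎
... | yes (i , j , eq) = (i , j , ij , refl) ◅
        pivot⇒Lₑ (rec (⊕-shrinks x endpoints i endpoints⊆x endpoints-i))
          -- From `G₁` the edge pivot leads back to `G`, and `P` leads on to `G′`.
          (⟨⟩-trans {G = G₁} (⟨⟩-sym (pivoting edge-pivot)) P)
  where
  ∧-true : ∀ {a b c} → (a ∧ b) ∧ c ≡ true → a ≡ true × b ≡ true × c ≡ true
  ∧-true {true} {true} {true} refl = refl , refl , refl

  xi : lookup x i ≡ true
  xi = proj₁ (∧-true {lookup x i} eq)

  ij : Edge G i j
  ij = proj₁ (proj₂ (∧-true {lookup x i} eq))

  xj : lookup x j ≡ true
  xj = proj₂ (proj₂ (∧-true {lookup x i} eq))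

  open EdgePivot (isAdj G) ij using (endpoints; edge-pivot; i≢j)

  G₁ : Graph _
  G₁ = G * i * j * i

  endpoints⊆x : ∀ k → lookup endpoints k ≡ true → lookup x k ≡ true
  endpoints⊆x k ek = lemma (trans (sym (lookup∘tabulate _ k)) ek)
    where
    lemma : does (i ≟ k) xor does (j ≟ k) ≡ true → lookup x k ≡ true
    lemma ek with i ≟ k | j ≟ k
    ... | yes refl | _        = xi
    ... | no  _    | yes refl = xj

  endpoints-i : lookup endpoints i ≡ true
  endpoints-i = trans (lookup∘tabulate _ i) lemma
    where
    lemma : does (i ≟ i) xor does (j ≟ i) ≡ true
    lemma with i ≟ i | j ≟ i
    ... | no i≢i | _        with () ← i≢i refl
    ... | yes _  | yes refl with () ← i≢j refl
    ... | yes _  | no  _    = refl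

-- Counting

HasCardinality-⇔ : ∀ {A : Set} {P Q : Pred A 0ℓ} {k} → (∀ a → a ∈ P ⇔ a ∈ Q) →
                   HasCardinality P k → HasCardinality Q k
HasCardinality-⇔ P⇔Q (xs , unique , members , len) =
  xs , unique ,
  (λ a → mk⇔ (Equivalence.to (P⇔Q a) ∘ Equivalence.to (members a))
             (Equivalence.from (members a) ∘ Equivalence.from (P⇔Q a))) ,
  len

length-cartesianProduct : ∀ {A B : Set} (xs : List A) (ys : List B) →
                          List.length (List.cartesianProduct xs ys) ≡ List.length xs ℕ.* List.length ys
length-cartesianProduct []       ys = refl
length-cartesianProduct (x ∷ xs) ys = trans (List.length-++ (List.map (x ,_) ys))
  (cong₂ ℕ._+_ (List.length-map (x ,_) ys) (length-cartesianProduct xs ys))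

HasCardinality-× : ∀ {A B : Set} {P : Pred A 0ℓ} {Q : Pred B 0ℓ} {k l} →
                   HasCardinality P k → HasCardinality Q l →
                   HasCardinality (λ (a , b) → P a × Q b) (k ℕ.* l)
HasCardinality-× (xs , xs! , xs⇔ , refl) (ys , ys! , ys⇔ , refl) =
  List.cartesianProduct xs ys ,
  Unique.cartesianProduct⁺ xs! ys! ,
  (λ (a , b) → mk⇔
    (λ ab∈ → let a∈ , b∈ = ∈-cartesianProduct⁻ xs ys ab∈
             in Equivalence.to (xs⇔ a) a∈ , Equivalence.to (ys⇔ b) b∈)
    (λ (Pa , Qb) → ∈-cartesianProduct⁺ (Equivalence.from (xs⇔ a) Pa) (Equivalence.from (ys⇔ b) Qb))) ,
  length-cartesianProduct xs ys

-- Injectivity is asked on list members because the maps in the counting argument are injective only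
-- on the set being counted.
map-unique : ∀ {A B : Set} {f : A → B} {xs} →
             (∀ {x y} → x List.∈ xs → y List.∈ xs → f x ≡ f y → x ≡ y) →
             Unique xs → Unique (List.map f xs)
map-unique f-inj []            = []
map-unique f-inj (x∉xs ∷ xs!) =
  All.map⁺ (All.tabulate λ y∈ fx≡fy → All.lookup x∉xs y∈ (f-inj (Any.here refl) (Any.there y∈) fx≡fy)) ∷
  map-unique (λ x∈ y∈ → f-inj (Any.there x∈) (Any.there y∈)) xs!

HasCardinality-bijection : ∀ {A B : Set} {P : Pred A 0ℓ} {Q : Pred B 0ℓ} {k} (f : A → B) →
  (∀ a → P a → Q (f a)) → (∀ a b → P a → P b → f a ≡ f b → a ≡ b) →
  (∀ b → Q b → ∃[ a ] P a × b ≡ f a) →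
  HasCardinality P k → HasCardinality Q k
HasCardinality-bijection {Q = Q} f f-Q f-inj f-surj (xs , xs! , xs⇔ , refl) =
  List.map f xs ,
  map-unique (λ x∈ y∈ → f-inj _ _ (Equivalence.to (xs⇔ _) x∈) (Equivalence.to (xs⇔ _) y∈)) xs! ,
  (λ b → mk⇔
    (λ b∈ → let a , a∈ , b≡fa = ∈-map⁻ f b∈ in subst Q (sym b≡fa) (f-Q a (Equivalence.to (xs⇔ a) a∈)))
    (λ Qb → let a , Pa , b≡fa = f-surj b Qb
            in subst (List._∈ List.map f xs) (sym b≡fa) (∈-map⁺ f (Equivalence.from (xs⇔ a) Pa)))) ,
  List.length-map f xs

-- The enumeration may repeat elements: `cardinality` deduplicates after filtering, which spares
-- uniqueness proofs for vectors, matrices and graphs.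
record Finite (A : Set) : Set where
  field
    _≟ᶠ_      : DecidableEquality A
    enumeration : List A
    complete    : ∀ a → a List.∈ enumeration

  exists? : {P : Pred A 0ℓ} → Decidable P → Dec (∃ P)
  exists? P? = map′ Any.satisfied (λ (a , Pa) → List.lose (complete a) Pa) (Any.any? P? enumeration)

  cardinality : {P : Pred A 0ℓ} → Decidable P → ∃[ k ] HasCardinality P k
  cardinality P? =
    _ , List.deduplicate _≟ᶠ_ (List.filter P? enumeration) ,
    DecUnique.deduplicate-! _≟ᶠ_ _ ,
    (λ a → mk⇔ (λ a∈ → proj₂ (∈-filter⁻ P? {xs = enumeration} (∈-deduplicate⁻ _≟ᶠ_ _ a∈)))
               (λ Pa → ∈-deduplicate⁺ _≟ᶠ_ (∈-filter⁺ P? (complete a) Pa))) ,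
    refl

open Finite using (exists?; cardinality)

finite-Vec : ∀ {A} → Finite A → ∀ n → Finite (Vec A n)
finite-Vec {A} fin n = record
  { _≟ᶠ_ = ≡-dec _≟ᶠ_ ; enumeration = vectors n ; complete = vectors-complete }
  where
  open Finite fin

  vectors : ∀ n → List (Vec A n)
  vectors zero    = [] ∷ []
  vectors (suc n) = List.cartesianProductWith _∷_ enumeration (vectors n)

  vectors-complete : ∀ {n} (v : Vec A n) → v List.∈ vectors n
  vectors-complete []      = Any.here refl
  vectors-complete (a ∷ v) = ∈-cartesianProductWith⁺ _∷_ (complete a) (vectors-complete v)

finite-𝔽₂ : Finite 𝔽₂
finite-𝔽₂ = record
  { _≟ᶠ_ = Bool._≟_
  ; enumeration = false ∷ true ∷ []
  ; complete = λ { false → Any.here refl ; true → Any.there (Any.here refl) }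
  }

finite-vectors : ∀ n → Finite (Vec 𝔽₂ n)
finite-vectors = finite-Vec finite-𝔽₂

isAdjacency? : Decidable (IsAdjacency {n})
isAdjacency? Γ = map′
  (λ (s , z) → record { symmetric = s ; zeroDiagonal = z })
  (λ adj → IsAdjacency.symmetric adj , IsAdjacency.zeroDiagonal adj)
  (all? (λ i → all? λ j → entry Γ i j Bool.≟ entry Γ j i) ×-dec all? λ i → entry Γ i i Bool.≟ false)

finite-graphs : ∀ n → Finite (Graph n)
finite-graphs n = record
  { _≟ᶠ_ = λ G G′ → map′ graph-≡ (cong adjacency) (adjacency G ≟ᶠ adjacency G′)
  ; enumeration = List.mapMaybe toGraph enumeration
  ; complete = graph-complete
  }
  where
  open Finite (finite-Vec (finite-vectors n) n)

  toGraph : Matrix n n → Maybe (Graph n)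
  toGraph Γ with isAdjacency? Γ
  ... | yes adj = just (graph Γ adj)
  ... | no  _   = nothing

  toGraph-adjacency : ∀ G → toGraph (adjacency G) ≡ just G
  toGraph-adjacency G with isAdjacency? (adjacency G)
  ... | yes _    = refl
  ... | no  ¬adj with () ← ¬adj (isAdj G)

  graph-complete : ∀ G → G List.∈ List.mapMaybe toGraph enumeration
  graph-complete G = Any.mapMaybe⁺ toGraph enumeration (Any.map⁺
    (List.lose (complete (adjacency G))
      (subst (Maybe.Any (G ≡_)) (sym (toGraph-adjacency G)) (Maybe.just refl))))

HasCardinality-nonZero : ∀ {A : Set} {P : Pred A 0ℓ} {k a} → P a → HasCardinality P k → NonZero k
HasCardinality-nonZero Pa ([] , _ , members , refl) with () ← Equivalence.from (members _) Pa
HasCardinality-nonZero Pa (_ ∷ _ , _ , _ , refl) = _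

-- The default makes the choice total, so that a pivot vector can be assigned to every graph; on
-- graphs in `Lₑ G` the default branch never arises.
witness : ∀ {A : Set} {P : Pred A 0ℓ} → A → Dec (∃ P) → A
witness _       (yes (a , _)) = a
witness default (no  _)       = default

witness-satisfies : ∀ {A : Set} {P : Pred A 0ℓ} {default : A} (P? : Dec (∃ P)) → ∃ P →
                    P (witness default P?)
witness-satisfies (yes (_ , Pa)) _  = Pa
witness-satisfies (no ∄P)        ∃P with () ← ∄P ∃P

-- Both sides are normalised from unnormalised fractions, so it suffices to cross-multiply.
/-cancel : ∀ l s .{{_ : NonZero s}} → (+ l) / 1 ≡ (+ (l ℕ.* s)) / s
/-cancel l s@(suc s-1) = fromℚᵘ-cong {mkℚᵘ (+ l) 0} {mkℚᵘ (+ (l ℕ.* s)) s-1}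
  (*≡* (trans (sym (ℤ.pos-* l s)) (sym (ℤ.*-identityʳ (+ (l ℕ.* s))))))

⊕-cancelʳ : (x y : Vec 𝔽₂ n) → (x ⊕ y) ⊕ y ≡ x
⊕-cancelʳ []      []      = refl
⊕-cancelʳ (a ∷ x) (b ∷ y) = cong₂ _∷_
  (trans (xor-assoc a b b) (trans (cong (a xor_) (xor-same b)) (xor-identityʳ a))) (⊕-cancelʳ x y)

-- The sets of the theorem in terms of pivots

module _ {n : ℕ} where

  infix 4 _⟨_⟩→?_

  _⟨_⟩→?_ : (G : Graph n) (x : Vec 𝔽₂ n) (G′ : Graph n) → Dec (G ⟨ x ⟩→ G′)
  G ⟨ x ⟩→? G′ = map′ (pivoting ∘ pivot) (λ (pivoting (pivot eq)) → eq) (≡-dec (≡-dec Bool._≟_) _ _)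

  Lₑ⇔pivot : (G G′ : Graph n) → (∃[ x ] G ⟨ x ⟩→ G′) ⇔ Lₑ G G′
  Lₑ⇔pivot G G′ = mk⇔ (λ (x , P) → pivot⇒Lₑ (⊂-wellFounded x) P) Lₑ⇒pivot

  denominator⇔Δₑ : (G : Graph n) (x : Vec 𝔽₂ n) →
                   Nonsingular (denominator (diag x) (adjacency G)) ⇔ x ∈ Δₑ G
  denominator⇔Δₑ G x = mk⇔
    (λ ns → isAdj G , ns , H-zeroDiagonal x (adjacency G) (isAdj G) ns)
    (λ (_ , ns , _) → ns)

  pivot⇒denominator : ∀ {G G′ : Graph n} {x} → G ⟨ x ⟩→ G′ →
                      Nonsingular (denominator (diag x) (adjacency G))
  pivot⇒denominator P =
    pivot⇒nonsingular (_⟨_⟩→_.isPivot P) (_⟨_⟩→_.isPivot (⟨⟩-sym P))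

  pivot⇔Δₑ : (G : Graph n) (x : Vec 𝔽₂ n) → (∃[ G′ ] G ⟨ x ⟩→ G′) ⇔ x ∈ Δₑ G
  pivot⇔Δₑ G x = mk⇔
    (λ (_ , P) → Equivalence.to (denominator⇔Δₑ G x) (pivot⇒denominator P))
    (λ (adj , ns , zd) →
      graph (H (diag x) (adjacency G) ns)
            (symmetric⇒adjacency (H-symmetric _ _ (diag-ᵀ x) (adjacency⇒symmetric adj) ns) zd) ,
      pivoting (pivot-H (diag x) (adjacency G) ns))

  pivot⇔Σₑ : (G : Graph n) (x : Vec 𝔽₂ n) → G ⟨ x ⟩→ G ⇔ x ∈ Σₑ G
  pivot⇔Σₑ G x = mk⇔ (λ P → to P (Equivalence.to (pivot⇔Δₑ G x) (G , P))) from
    where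
    Γ : Matrix n n
    Γ = adjacency G

    fixed : G ⟨ x ⟩→ G → ((_ , ns , _) : Δₑ G x) → H (diag x) Γ ns ≡ Γ
    fixed (pivoting P) (_ , ns , _) = pivot⇒≡H {A = diag x} {Γ} {Γ} P ns

    to : G ⟨ x ⟩→ G → Δₑ G x → Σₑ G x
    to P x∈ = x∈ , fixed P x∈

    from : Σₑ G x → G ⟨ x ⟩→ G
    from ((_ , ns , _) , H≡Γ) = pivoting (subst (Pivot (diag x) Γ) H≡Γ (pivot-H (diag x) Γ ns))

  -- Subsets and vectors over 𝔽₂ are the same type, so the two sets coincide, and the equality of
  -- their cardinalities takes no further bijection.
  submatrix⇔Δₑ : (G : Graph n) (ω : Subset n) → ω ∈ Δₑ G ⇔ Nonsingular (adjacency G ⟦ ω ⟧)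
  submatrix⇔Δₑ G ω = mk⇔
    (denominator⇒submatrix ω (adjacency G) ∘ Equivalence.from (denominator⇔Δₑ G ω))
    (Equivalence.to (denominator⇔Δₑ G ω) ∘ submatrix⇒denominator ω (adjacency G))

  Σₑ⇔equation : (G : Graph n) (x : Vec 𝔽₂ n) →
                x ∈ Σₑ G ⇔ ((adjacency G ⊞ 𝟙) ⊡ diag x ⊡ (adjacency G ⊞ 𝟙) ≡ 𝟘)
  Σₑ⇔equation G x = mk⇔
    (λ x∈ → trans (Pivot.equation (_⟨_⟩→_.isPivot (Equivalence.from (pivot⇔Σₑ G x) x∈)))
                  (⊞-same (adjacency G)))
    (λ eq → Equivalence.to (pivot⇔Σₑ G x) (pivoting (pivot (trans eq (sym (⊞-same (adjacency G)))))))

  -- Choosing y(G′) with H^y(G) = G′, the fibre of x ↦ H^x(G) over G′ is the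
  -- translate of Σₑ(G) by y(G′).
  Δₑ-cardinality : (G : Graph n) {l s : ℕ} → HasCardinality (Lₑ G) l → HasCardinality (Σₑ G) s →
                   HasCardinality (Δₑ G) (l ℕ.* s)
  Δₑ-cardinality G #Lₑ #Σₑ =
    HasCardinality-bijection translate into injective surjective (HasCardinality-× #Lₑ #Σₑ)
    where
    chosen? : ∀ G′ → Dec (∃[ y ] G ⟨ y ⟩→ G′)
    chosen? G′ = exists? (finite-vectors n) (λ y → G ⟨ y ⟩→? G′)

    chosen : Graph n → Vec 𝔽₂ n
    chosen G′ = witness (replicate n false) (chosen? G′)

    chosen-pivot : ∀ {G′} → Lₑ G G′ → G ⟨ chosen G′ ⟩→ G′
    chosen-pivot {G′} G~G′ = witness-satisfies (chosen? G′) (Lₑ⇒pivot G~G′)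

    translate : Graph n × Vec 𝔽₂ n → Vec 𝔽₂ n
    translate (G′ , z) = z ⊕ chosen G′

    Pairs : Pred (Graph n × Vec 𝔽₂ n) 0ℓ
    Pairs (G′ , z) = Lₑ G G′ × Σₑ G z

    translate-pivot : ∀ p → Pairs p → G ⟨ translate p ⟩→ proj₁ p
    translate-pivot (G′ , z) (G~G′ , z∈) =
      ⟨⟩-trans (Equivalence.from (pivot⇔Σₑ G z) z∈) (chosen-pivot G~G′)

    into : ∀ p → Pairs p → Δₑ G (translate p)
    into p p∈ = Equivalence.to (pivot⇔Δₑ G (translate p)) (proj₁ p , translate-pivot p p∈)

    injective : ∀ p p′ → Pairs p → Pairs p′ → translate p ≡ translate p′ → p ≡ p′
    injective p p′ p∈ p′∈ eq =
      -- Equal translates lead from `G` to the same graph, hence were shifted by the same chosen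
      -- vector, which cancels.
      lemma (⟨⟩-unique (subst (λ x → G ⟨ x ⟩→ proj₁ p) eq (translate-pivot p p∈))
                       (translate-pivot p′ p′∈)) eq
      where
      lemma : ∀ {G₁ G₂ z₁ z₂} → G₁ ≡ G₂ → translate (G₁ , z₁) ≡ translate (G₂ , z₂) →
              (G₁ , z₁) ≡ (G₂ , z₂)
      lemma {G₁} {z₁ = z₁} {z₂} refl eq = cong (G₁ ,_) (begin
        z₁                             ≡⟨ ⊕-cancelʳ z₁ (chosen G₁) ⟨
        (z₁ ⊕ chosen G₁) ⊕ chosen G₁   ≡⟨ cong (_⊕ chosen G₁) eq ⟩
        (z₂ ⊕ chosen G₁) ⊕ chosen G₁   ≡⟨ ⊕-cancelʳ z₂ (chosen G₁) ⟩
        z₂                             ∎)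

    surjective : ∀ x → Δₑ G x → ∃[ p ] Pairs p × x ≡ translate p
    surjective x x∈ =
      let G′ , P = Equivalence.from (pivot⇔Δₑ G x) x∈
          G~G′   = Equivalence.to (Lₑ⇔pivot G G′) (x , P)
      -- Going to `G′` by x and back by the chosen vector fixes `G`, so the sum lies in `Σₑ G`.
      in (G′ , x ⊕ chosen G′) ,
         (G~G′ , Equivalence.to (pivot⇔Σₑ G (x ⊕ chosen G′)) (⟨⟩-trans P (⟨⟩-sym (chosen-pivot G~G′)))) ,
         sym (⊕-cancelʳ x (chosen G′))

mainTheorem3 : (n : ℕ) (G : Graph n) →
    (∃[ l ] ∃[ d ] ∃[ s ] Σ[ s≢0 ∈ NonZero s ]
    HasCardinality (Lₑ G) l ×
    HasCardinality (Δₑ G) d ×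
    HasCardinality (Σₑ G) s ×
    ((+ l) / 1 ≡ ((+ d) / s) {{s≢0}}) ×
    HasCardinality (λ ω → Nonsingular (adjacency G ⟦ ω ⟧)) d) ×
    ((x : Vec 𝔽₂ n) →
    (x ∈ Σₑ G) ⇔ ((adjacency G ⊞ 𝟙) ⊡ diag x ⊡ (adjacency G ⊞ 𝟙) ≡ 𝟘))
mainTheorem3 n G =
  -- The decidable pivot predicates are counted, and the counts are then transported to `Lₑ` and
  -- `Σₑ`.
  let l , #pivots      = cardinality (finite-graphs n) λ G′ →
                           exists? (finite-vectors n) λ x → G ⟨ x ⟩→? G′
      s , #stabiliser  = cardinality (finite-vectors n) λ x → G ⟨ x ⟩→? G
      -- The zero vector fixes `G`, so the divisor is positive.
      s≢0              = HasCardinality-nonZero ⟨⟩-refl #stabiliser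
      #Lₑ              = HasCardinality-⇔ (Lₑ⇔pivot G) #pivots
      #Σₑ              = HasCardinality-⇔ (pivot⇔Σₑ G) #stabiliser
      #Δₑ              = Δₑ-cardinality G #Lₑ #Σₑ
  in (l , l ℕ.* s , s , s≢0 , #Lₑ , #Δₑ , #Σₑ , /-cancel l s {{s≢0}} ,
      HasCardinality-⇔ (submatrix⇔Δₑ G) #Δₑ) ,
     Σₑ⇔equation G
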